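{- Let $m>n\ge1$ and $q,\alpha,\beta\ge1$ be integers with $\gcd(\alpha,\beta)=1$, let $p=\gcd(m,n)$, and let $C(n,q\alpha)\in\{a<z\}^n$ and $C(m,q\beta)\in\{b<z\}^m$ be two superimposable Christoffel words. Let $(x,y)$ be the solution in positive integers of $$x\alpha+y\beta=p-2\alpha\beta(q-1)$$ such that $y\le\alpha$. Then the number of superimpositions of $C(n,q\alpha)$ and $C(m,q\beta)$ is (i) $xy\,\dfrac mp$, if $x\le\beta$; (ii) $(x\alpha+y\beta-\alpha\beta)\,\dfrac mp$, if $x>\beta$.
   Context: For coprime $s,t\in\{0,1,2,\dots\}$ and $n=s+t$, the Christoffel word over the ordered alphabet $\{a<z\}$ with $s$ occurrences of $a$ and $t$ occurrences of $z$ is $u=u[0]u[1]\cdots u[n-1]$ with $u[i]=a$ if $((i+1)t \bmod n)>(it\bmod n)$ and $u[i]=z$ otherwise. It is denoted $C(n,s)$; calling $C(n,s)$ a Christoffel word presupposes $\gcd(n,s)=1$. Over $\{b<z\}$ the definition is the same with $b$ in place of $a$. For a letter $c$ and a finite word $w$, $\gamma(cw)=wc$; $\gamma$ is a bijection on words of a given length, and $\gamma^k$ is defined for all $k\in\mathbb Z$. Let $u\in\{a,z\}^n$ and $v\in\{b,z\}^m$, let $A$ be the set of positions (indexed from $0$) of the letter $a$ in $u$ and $B$ the set of positions of the letter $b$ in $v$. The words $u,v$ are perfectly superimposable if $(A+n\mathbb Z)\cap(B+m\mathbb Z)=\emptyset$, and superimposable if there is $k\in\mathbb Z$ with $(A+n\mathbb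 Z)\cap(B-k+m\mathbb Z)=\emptyset$ (equivalently, $u$ and $\gamma^k(v)$ are perfectly superimposable for some $k$). For superimposable Christoffel words $C(n,s)$ and $C(m,t)$ with $m>n$, the number of superimpositions is the number of $k\in\{0,1,\dots,m-1\}$ such that $C(n,s)$ and $\gamma^kC(m,t)$ are perfectly superimposable. -}

module Defs where

open import Data.Bool.Base using (if_then_else_)
open import Data.Fin.Base using (Fin; toℕ)
open import Data.Fin.Properties using (any?; nonZeroIndex)
open import Data.Integer.Base as ℤ using (ℤ; +_)
import Data.Integer.Divisibility.Signed as ℤ
import Data.Integer.Properties as ℤ
open import Data.Integer.Tactic.RingSolver using (solve-∀)
open import Data.List.Base using (length; filter; upTo)
open import Data.Nat.Base using (ℕ; zero; suc; _+_; _*_; _∸_; NonZero; ≢-nonZero; ≢-nonZero⁻¹)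
open import Data.Nat.DivMod using (_%_)
open import Data.Nat.GCD using (gcd; gcd[m,n]∣m; gcd[m,n]∣n; gcd-GCD; module Bézout; gcd[m,n]≢0)
open import Data.Nat.Properties using (_<?_)
open import Data.Product.Base using (∃; ∃-syntax; _×_; _,_)
open import Data.Sum.Base using (inj₂)
open import Data.Vec.Base using (Vec; []; _∷_; _∷ʳ_; lookup; tabulate)
open import Level using (0ℓ)
open import Relation.Binary.Definitions using (DecidableEquality)
open import Relation.Binary.PropositionalEquality
open import Relation.Nullary using (Dec; yes; no; ¬?; ⌊_⌋; _×-dec_)
open import Relation.Nullary.Decidable using (map′)
open import Relation.Unary using (Pred; _∈_; _∩_; Empty)

data Letter : Set where
  a b z : Letter

Word : ℕ → Set
Word n = Vec Letter n

-- The Christoffel word C(n , s) over {c < z}; meaningful for s ≤ n, gcd n s ≡ 1.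
-- At n = s = 1 the comparison 0 > 0 fails, so the formula yields z, not c.
C : Letter → (n s : ℕ) → Word n
C c n s = tabulate letter
  where
  t : ℕ
  t = n ∸ s
  letter : Fin n → Letter
  letter i = if ⌊ (toℕ i * t) % n <? (suc (toℕ i) * t) % n ⌋ then c else z
    where instance _ = nonZeroIndex i

γ : ∀ {n} → Word n → Word n
γ []      = []
γ (c ∷ w) = w ∷ʳ c

γ^ : ∀ {n} → ℕ → Word n → Word n
γ^ zero    w = w
γ^ (suc k) w = γ (γ^ k w)

positions : ∀ {n} → Letter → Word n → Pred ℤ 0ℓ
positions c w x = ∃[ i ] lookup w i ≡ c × x ≡ + toℕ i

-- S + n ℤ
_+[_]ℤ : Pred ℤ 0ℓ → ℕ → Pred ℤ 0ℓ
(S +[ n ]ℤ) x = ∃[ y ] y ∈ S × ∃[ j ] x ≡ y ℤ.+ + n ℤ.* j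

-- S - k
_⊖_ : Pred ℤ 0ℓ → ℤ → Pred ℤ 0ℓ
(S ⊖ k) x = x ℤ.+ k ∈ S

-- The first word is read over {a , z}, the second over {b , z}.
PerfectlySuperimposable : ∀ {n m} → Word n → Word m → Set
PerfectlySuperimposable {n} {m} u v =
  Empty ((positions a u +[ n ]ℤ) ∩ (positions b v +[ m ]ℤ))

Superimposable : ∀ {n m} → Word n → Word m → Set
Superimposable {n} {m} u v =
  ∃[ k ] Empty ((positions a u +[ n ]ℤ) ∩ ((positions b v ⊖ k) +[ m ]ℤ))

_≟_ : DecidableEquality Letter
a ≟ a = yes refl
a ≟ b = no λ ()
a ≟ z = no λ ()
b ≟ a = no λ ()
b ≟ b = yes refl
b ≟ z = no λ ()
z ≟ a = no λ ()
z ≟ b = no λ ()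
z ≟ z = yes refl

pos-identity : ∀ d p q r s → d + p * q ≡ r * s → + d ℤ.+ + p ℤ.* + q ≡ + r ℤ.* + s
pos-identity d p q r s e =
  trans (cong (λ w → + d ℤ.+ w) (sym (ℤ.pos-* p q))) (trans (cong +_ e) (ℤ.pos-* r s))

bézout : ∀ m n → ∃[ x ] ∃[ y ] + gcd m n ≡ x ℤ.* + m ℤ.+ y ℤ.* + n
bézout m n with Bézout.identity (gcd-GCD m n)
... | Bézout.+- x y eq = + x , ℤ.- + y , lemma (+ gcd m n) (+ x) (+ y) (+ m) (+ n) (pos-identity (gcd m n) y n x m eq)
  where
  cancel : ∀ d y n → d ≡ (d ℤ.+ y ℤ.* n) ℤ.+ (ℤ.- y) ℤ.* n
  cancel = solve-∀
  lemma : ∀ d x y m n → d ℤ.+ y ℤ.* n ≡ x ℤ.* m → d ≡ x ℤ.* m ℤ.+ (ℤ.- y) ℤ.* n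
  lemma d x y m n e = trans (cancel d y n) (cong (λ w → w ℤ.+ (ℤ.- y) ℤ.* n) e)
... | Bézout.-+ x y eq = ℤ.- + x , + y , lemma (+ gcd m n) (+ x) (+ y) (+ m) (+ n) (pos-identity (gcd m n) x m y n eq)
  where
  cancel : ∀ d x m → d ≡ (ℤ.- x) ℤ.* m ℤ.+ (d ℤ.+ x ℤ.* m)
  cancel = solve-∀
  lemma : ∀ d x y m n → d ℤ.+ x ℤ.* m ≡ y ℤ.* n → d ≡ (ℤ.- x) ℤ.* m ℤ.+ y ℤ.* n
  lemma d x y m n e = trans (cancel d x m) (cong (λ w → (ℤ.- x) ℤ.* m ℤ.+ w) e)

-- (x + n ℤ) ∩ (y + m ℤ) is inhabited iff gcd n m ∣ x - y.
meet? : ∀ n m x y → Dec (∃[ j ] ∃[ k ] x ℤ.+ + n ℤ.* j ≡ y ℤ.+ + m ℤ.* k)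
meet? n m x y = map′ to from (+ gcd n m ℤ.∣? (x ℤ.- y))
  where
  to : + gcd n m ℤ.∣ (x ℤ.- y) → ∃[ j ] ∃[ k ] x ℤ.+ + n ℤ.* j ≡ y ℤ.+ + m ℤ.* k
  to (ℤ.divides q eq) with e , f , g≡ ← bézout n m =
    ℤ.- (q ℤ.* e) , q ℤ.* f ,
    (begin
      x ℤ.+ + n ℤ.* ℤ.- (q ℤ.* e)                                ≡⟨ split x y (+ n) q e ⟩
      y ℤ.+ ((x ℤ.- y) ℤ.- q ℤ.* (e ℤ.* + n))                    ≡⟨ cong (λ d → y ℤ.+ (d ℤ.- q ℤ.* (e ℤ.* + n))) (trans eq (cong (q ℤ.*_) g≡)) ⟩
      y ℤ.+ (q ℤ.* (e ℤ.* + n ℤ.+ f ℤ.* + m) ℤ.- q ℤ.* (e ℤ.* + n)) ≡⟨ merge y (+ n) (+ m) q e f ⟩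
      y ℤ.+ + m ℤ.* (q ℤ.* f)                                    ∎)
    where
    open ≡-Reasoning
    split : ∀ x y n q e → x ℤ.+ n ℤ.* ℤ.- (q ℤ.* e) ≡ y ℤ.+ ((x ℤ.- y) ℤ.- q ℤ.* (e ℤ.* n))
    split = solve-∀
    merge : ∀ y n m q e f →
      y ℤ.+ (q ℤ.* (e ℤ.* n ℤ.+ f ℤ.* m) ℤ.- q ℤ.* (e ℤ.* n)) ≡ y ℤ.+ m ℤ.* (q ℤ.* f)
    merge = solve-∀
  from : (∃[ j ] ∃[ k ] x ℤ.+ + n ℤ.* j ≡ y ℤ.+ + m ℤ.* k) → + gcd n m ℤ.∣ (x ℤ.- y)
  from (j , k , eq) = subst (+ gcd n m ℤ.∣_) (sym x-y≡)
    (ℤ.∣m∣n⇒∣m-n (ℤ.∣m⇒∣m*n {m = + m} k (ℤ.∣ᵤ⇒∣ (gcd[m,n]∣n n m))) (ℤ.∣m⇒∣m*n {m = + n} j (ℤ.∣ᵤ⇒∣ (gcd[m,n]∣m n m))))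
    where
    split : ∀ x y u → x ℤ.- y ≡ (x ℤ.+ u) ℤ.- y ℤ.- u
    split = solve-∀
    merge : ∀ y u v → (y ℤ.+ v) ℤ.- y ℤ.- u ≡ v ℤ.- u
    merge = solve-∀
    x-y≡ : x ℤ.- y ≡ + m ℤ.* k ℤ.- + n ℤ.* j
    x-y≡ = trans (split x y (+ n ℤ.* j))
          (trans (cong (λ w → w ℤ.- y ℤ.- + n ℤ.* j) eq) (merge y (+ n ℤ.* j) (+ m ℤ.* k)))

perfectlySuperimposable? : ∀ {n m} (u : Word n) (v : Word m) → Dec (PerfectlySuperimposable u v)
perfectlySuperimposable? {n} {m} u v =
  map′ to from (¬? (any? λ i → any? λ i′ →
    (lookup u i ≟ a) ×-dec (lookup v i′ ≟ b) ×-dec meet? n m (+ toℕ i) (+ toℕ i′)))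
  where
  Clash : Set
  Clash = ∃[ i ] ∃[ i′ ] lookup u i ≡ a × lookup v i′ ≡ b ×
    (∃[ j ] ∃[ k ] + toℕ i ℤ.+ + n ℤ.* j ≡ + toℕ i′ ℤ.+ + m ℤ.* k)
  to : (Clash → _) → PerfectlySuperimposable u v
  to ¬clash x ((_ , (i , ui , refl) , j , p) , (_ , (i′ , vi′ , refl) , k , r)) =
    ¬clash (i , i′ , ui , vi′ , j , k , trans (sym p) r)
  from : PerfectlySuperimposable u v → Clash → _
  from empty (i , i′ , ui , vi′ , j , k , eq) =
    empty _ ((_ , (i , ui , refl) , j , refl) , (_ , (i′ , vi′ , refl) , k , eq))

#superimpositions : ∀ {n m} → Word n → Word m → ℕ
#superimpositions {m = m} u v =
  length (filter (λ k → perfectlySuperimposable? u (γ^ k v)) (upTo m))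

gcd-nonZero : ∀ m n .{{_ : NonZero n}} → NonZero (gcd m n)
gcd-nonZero m n = ≢-nonZero (gcd[m,n]≢0 m n (inj₂ (≢-nonZero⁻¹ n)))

{-# OPTIONS --safe #-}
module Submission where

-- Modulo p = gcd(m, n), the word C(n, s) has its letter at x iff x s ≡ −r for some 0 ≤ r < s. Hence the shift k
-- produces a clash iff D = k q α β satisfies D + r′α ≡ rβ (mod p) for some 0 ≤ r < qα and 0 ≤ r′ < qβ (D is "hit"),
-- and, qαβ being invertible modulo p, the number of superimpositions is m/p times the number of unhit residues.
--
-- Put Q = (q − 1)αβ. The integers not of the form r′α − rβ with these bounds are exactly −Q − (i + 1)α − jβ and
-- Q + iα + (j + 1)β with i, j ≥ 0. The former are negative and the latter positive, so 0 ≤ D < p is unhit iff −D is of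
-- the first kind and p − D of the second. Since p = xα + yβ + 2Q, this means D = Q + (i + 1)α + jβ where, for
-- the normalisation 0 ≤ j < α, either i < x and j < y, or i < x − β and y ≤ j < α. There are
-- xy + max(x − β, 0)(α − y) such pairs (i, j).

open import Defs
open import Data.Bool.Base using (if_then_else_)
open import Data.Fin.Base as Fin using (Fin; toℕ; fromℕ<)
open import Data.Fin.Properties as Fin using (toℕ<n; toℕ-injective; toℕ-fromℕ<; injective⇒≤; *↔×; +↔⊎)
open import Data.Fin.Relation.Unary.Top using (view; ‵fromℕ; ‵inject₁)
open import Data.Integer.Base as ℤ using (ℤ; +_)
import Data.Integer.DivMod as ℤ
import Data.Integer.Divisibility.Signed as ℤ
import Data.Integer.Properties as ℤ
import Data.Integer.Tactic.RingSolver as ℤ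
open import Data.List.Base using (List; length; lookup; filter; upTo)
open import Data.List.Membership.Propositional using (_∈_)
open import Data.List.Membership.Propositional.Properties using (∈-lookup; ∈-filter⁺; ∈-filter⁻; ∈-upTo⁺; ∈-upTo⁻)
import Data.List.Relation.Unary.All as All
import Data.List.Relation.Unary.Any as Any
import Data.List.Relation.Unary.Any.Properties as Any
open import Data.List.Relation.Unary.AllPairs.Core using (_∷_)
open import Data.List.Relation.Unary.Unique.Propositional using (Unique)
import Data.List.Relation.Unary.Unique.Propositional.Properties as Unique
open import Data.Nat.Base using (ℕ; zero; suc; _+_; _*_; _∸_; _≤_; _<_; _>_; z≤n; s≤s; _/_; _%_; NonZero; >-nonZero; >-nonZero⁻¹)
open import Data.Nat.Coprimality as Coprimality using (Coprime; coprime-divisor; gcd≡1⇒coprime; coprime⇒gcd≡1)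
open import Data.Nat.Divisibility using (divides; ∣-refl; ∣⇒≤; divides-refl; ∣-trans; m∣m*n; n∣m*n; _∣_; ∣m+n∣m⇒∣n)
open import Data.Nat.DivMod using (m≡m%n+[m/n]*n; m%n<n; [m+kn]%n≡m%n; m<n⇒m%n≡m; m*n/n≡m; +-distrib-/-∣ʳ; m<n⇒m/n≡0; m/n*n≡m; m<n*o⇒m/o<n)
open import Data.Nat.GCD using (gcd; gcd[m,n]∣m; gcd[m,n]∣n)
open import Data.Nat.Properties
open import Data.Nat.Tactic.RingSolver using (solve-∀)
open import Data.Product.Base using (∃-syntax; _×_; _,_; proj₁; proj₂)
open import Data.Sum.Base using (_⊎_; inj₁; inj₂)
open import Data.Product.Function.NonDependent.Propositional using (_×-↔_)
open import Data.Sum.Function.Propositional using (_⊎-↔_)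
open import Data.Vec.Base as Vec using ([]; _∷_; _∷ʳ_)
open import Data.Vec.Properties using (lookup∘tabulate)
open import Function.Bundles using (Equivalence; Inverse; _↔_; _⇔_; mk⇔)
open import Function.Properties.Equivalence using () renaming (refl to ⇔-refl; trans to ⇔-trans)
open import Function.Construct.Composition using (_↔-∘_)
open import Function.Construct.Identity using (↔-id)
open import Function.Related.TypeIsomorphisms using (¬-cong-⇔)
open import Relation.Binary.PropositionalEquality using (_≡_; _≢_; refl; sym; trans; cong; cong₂; subst; subst₂; module ≡-Reasoning)
open import Relation.Nullary using (Dec; ¬_; ⌊_⌋; yes; no; contradiction)

-- Congruences

∣-resp : ∀ {n : ℤ} {x y} → x ≡ y → n ℤ.∣ x → n ℤ.∣ y
∣-resp refl n∣x = n∣x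

∣-diff⇒∣ : ∀ {n} u w → + n ℤ.∣ + (u + w) ℤ.- + u → n ∣ w
∣-diff⇒∣ u w h = ℤ.∣⇒∣ᵤ (∣-resp (eq (+ u) (+ w)) h)
  where
  eq : ∀ u w → (u ℤ.+ w) ℤ.- u ≡ w
  eq = ℤ.solve-∀

∣-diff-sym : ∀ {n : ℤ} x y → n ℤ.∣ x ℤ.- y → n ℤ.∣ y ℤ.- x
∣-diff-sym x y h = ∣-resp (eq x y) (ℤ.∣m⇒∣-m h)
  where
  eq : ∀ x y → ℤ.- (x ℤ.- y) ≡ y ℤ.- x
  eq = ℤ.solve-∀

-- Turns an integer congruence into an equation of natural numbers, the multiple of `n` standing on
-- the side of the smaller number. The `suc c` keeps the alternatives apart for `n` positive:
-- equality falls under the first, with `c` zero.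
∣-diff⇒≡+* : ∀ {n} u v → + n ℤ.∣ + u ℤ.- + v →
  (∃[ c ] u ≡ v + c * n) ⊎ (∃[ c ] v ≡ u + suc c * n)
∣-diff⇒≡+* u v h with ≤-total u v
... | inj₂ v≤u with m≤n⇒∃[o]m+o≡n v≤u
... | w , refl with ∣-diff⇒∣ v w h
... | divides c refl = inj₁ (c , refl)
∣-diff⇒≡+* u v h | inj₁ u≤v with m≤n⇒∃[o]m+o≡n u≤v
... | w , refl with ∣-diff⇒∣ u w (∣-diff-sym (+ u) (+ (u + w)) h)
... | divides zero refl    = inj₁ (0 , sym (trans (+-identityʳ (u + 0)) (+-identityʳ u)))
... | divides (suc c) refl = inj₂ (c , refl)

residue-unique : ∀ {n u v} → u < n → v < n → + n ℤ.∣ + u ℤ.- + v → u ≡ v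
residue-unique {n} {u} {v} u<n v<n h with ∣-diff⇒≡+* u v h
... | inj₁ (zero , refl)  = +-identityʳ v
... | inj₁ (suc c , refl) = contradiction (≤-trans (m≤m+n n (c * n)) (m≤n+m _ v)) (<⇒≱ u<n)
... | inj₂ (c , refl)     = contradiction (≤-trans (m≤m+n n (c * n)) (m≤n+m _ u)) (<⇒≱ v<n)

coprime-bézout : ∀ {n c} → Coprime n c → ∃[ x ] ∃[ y ] + 1 ≡ x ℤ.* + n ℤ.+ y ℤ.* + c
coprime-bézout {n} {c} co with bézout n c
... | x , y , eq = x , y , trans (cong +_ (sym (coprime⇒gcd≡1 co))) eq

-- Multiply the Bézout identity 1 = xn + yc by `w`: both terms on the right are then multiples of
-- `n`.
∣-cancelʳ : ∀ {n c} → Coprime n c → ∀ w → + n ℤ.∣ w ℤ.* + c → + n ℤ.∣ w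
∣-cancelʳ {n} {c} co w (ℤ.divides k eq) with coprime-bézout co
... | x , y , 1≡ = ℤ.divides (w ℤ.* x ℤ.+ y ℤ.* k) (begin
  w                                        ≡⟨ ℤ.*-identityʳ w ⟨
  w ℤ.* + 1                                ≡⟨ cong (w ℤ.*_) 1≡ ⟩
  w ℤ.* (x ℤ.* + n ℤ.+ y ℤ.* + c)          ≡⟨ e₁ w x y (+ n) (+ c) ⟩
  w ℤ.* x ℤ.* + n ℤ.+ y ℤ.* (w ℤ.* + c)    ≡⟨ cong (λ h → w ℤ.* x ℤ.* + n ℤ.+ y ℤ.* h) eq ⟩
  w ℤ.* x ℤ.* + n ℤ.+ y ℤ.* (k ℤ.* + n)    ≡⟨ e₂ (w ℤ.* x) y k (+ n) ⟩
  (w ℤ.* x ℤ.+ y ℤ.* k) ℤ.* + n            ∎)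
  where
  open ≡-Reasoning
  e₁ : ∀ w x y n c → w ℤ.* (x ℤ.* n ℤ.+ y ℤ.* c) ≡ w ℤ.* x ℤ.* n ℤ.+ y ℤ.* (w ℤ.* c)
  e₁ = ℤ.solve-∀
  e₂ : ∀ u y k n → u ℤ.* n ℤ.+ y ℤ.* (k ℤ.* n) ≡ (u ℤ.+ y ℤ.* k) ℤ.* n
  e₂ = ℤ.solve-∀

-- The Bézout coefficient y of `c` is its inverse modulo `n`, so the solution is the residue of d y.
solve-congruence : ∀ {n c} .{{_ : NonZero n}} → Coprime n c → ∀ d →
  ∃[ r ] r < n × + n ℤ.∣ + r ℤ.* + c ℤ.- d
solve-congruence {n} {c} co d with coprime-bézout co
... | x , y , 1≡ = r , ℤ.n%ℕd<d (d ℤ.* y) n , ℤ.divides (ℤ.- (t ℤ.* + c ℤ.+ d ℤ.* x)) (begin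
  + r ℤ.* + c ℤ.- d                                                ≡⟨ e₁ (+ r) t (+ c) d (+ n) ⟩
  (+ r ℤ.+ t ℤ.* + n) ℤ.* + c ℤ.- t ℤ.* + n ℤ.* + c ℤ.- d ℤ.* + 1
    ≡⟨ cong₂ (λ u v → u ℤ.* + c ℤ.- t ℤ.* + n ℤ.* + c ℤ.- d ℤ.* v) (sym (ℤ.a≡a%ℕn+[a/ℕn]*n (d ℤ.* y) n)) 1≡ ⟩
  d ℤ.* y ℤ.* + c ℤ.- t ℤ.* + n ℤ.* + c ℤ.- d ℤ.* (x ℤ.* + n ℤ.+ y ℤ.* + c) ≡⟨ e₂ x y t (+ c) d (+ n) ⟩
  ℤ.- (t ℤ.* + c ℤ.+ d ℤ.* x) ℤ.* + n                              ∎)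
  where
  open ≡-Reasoning
  r = (d ℤ.* y) ℤ.%ℕ n
  t = (d ℤ.* y) ℤ./ℕ n
  e₁ : ∀ r t c d n → r ℤ.* c ℤ.- d ≡ (r ℤ.+ t ℤ.* n) ℤ.* c ℤ.- t ℤ.* n ℤ.* c ℤ.- d ℤ.* + 1
  e₁ = ℤ.solve-∀
  e₂ : ∀ x y t c d n → d ℤ.* y ℤ.* c ℤ.- t ℤ.* n ℤ.* c ℤ.- d ℤ.* (x ℤ.* n ℤ.+ y ℤ.* c) ≡ ℤ.- (t ℤ.* c ℤ.+ d ℤ.* x) ℤ.* n
  e₂ = ℤ.solve-∀

-- With x - y = h gcd(m, n) and gcd(m, n) = em + fn, the number x - hem equals y + hfn.
chinese-remainder : ∀ m n x y → + gcd m n ℤ.∣ x ℤ.- y → ∃[ w ] + m ℤ.∣ w ℤ.- x × + n ℤ.∣ w ℤ.- y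
chinese-remainder m n x y (ℤ.divides h eq) with bézout m n
... | e , f , g≡ = x ℤ.- h ℤ.* e ℤ.* + m , ℤ.divides (ℤ.- (h ℤ.* e)) (e₁ x h e (+ m)) , ℤ.divides (h ℤ.* f) (begin
  (x ℤ.- h ℤ.* e ℤ.* + m) ℤ.- y                                ≡⟨ e₂ x y (h ℤ.* e ℤ.* + m) ⟩
  (x ℤ.- y) ℤ.- h ℤ.* e ℤ.* + m                                ≡⟨ cong (λ v → v ℤ.- h ℤ.* e ℤ.* + m) (trans eq (cong (h ℤ.*_) g≡)) ⟩
  h ℤ.* (e ℤ.* + m ℤ.+ f ℤ.* + n) ℤ.- h ℤ.* e ℤ.* + m          ≡⟨ e₃ h e f (+ m) (+ n) ⟩
  h ℤ.* f ℤ.* + n                                              ∎)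
  where
  open ≡-Reasoning
  e₁ : ∀ x h e m → (x ℤ.- h ℤ.* e ℤ.* m) ℤ.- x ≡ ℤ.- (h ℤ.* e) ℤ.* m
  e₁ = ℤ.solve-∀
  e₂ : ∀ x y u → (x ℤ.- u) ℤ.- y ≡ (x ℤ.- y) ℤ.- u
  e₂ = ℤ.solve-∀
  e₃ : ∀ h e f m n → h ℤ.* (e ℤ.* m ℤ.+ f ℤ.* n) ℤ.- h ℤ.* e ℤ.* m ≡ h ℤ.* f ℤ.* n
  e₃ = ℤ.solve-∀

coprime-*ʳ : ∀ {n c d} → Coprime n c → Coprime n d → Coprime n (c * d)
coprime-*ʳ n⊥c n⊥d (h∣n , h∣cd) =
  n⊥d (h∣n , coprime-divisor (λ (e∣h , e∣c) → n⊥c (∣-trans e∣h h∣n , e∣c)) h∣cd)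

coprime-∣ : ∀ {m n c d} → m ∣ n → c ∣ d → Coprime n d → Coprime m c
coprime-∣ m∣n c∣d n⊥d (h∣m , h∣c) = n⊥d (∣-trans h∣m m∣n , ∣-trans h∣c c∣d)

-- Occurrences of a letter in a periodically repeated word

module _ (n s : ℕ) .{{_ : NonZero n}} (s<n : s < n) (u : ℕ) where
  private
    t ρ : ℕ
    t = n ∸ s
    ρ = (u * t) % n

    s+t≡n : s + t ≡ n
    s+t≡n = m+[n∸m]≡n (<⇒≤ s<n)

    step : (suc u * t) % n ≡ (t + ρ) % n
    step = trans (cong (λ v → (t + v) % n) (m≡m%n+[m/n]*n (u * t) n))
      (trans (cong (_% n) (sym (+-assoc t ρ _))) ([m+kn]%n≡m%n (t + ρ) ((u * t) / n) n))

    n∣us+ρ : + n ℤ.∣ + u ℤ.* + s ℤ.+ + ρ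
    n∣us+ρ = ℤ.divides (+ u ℤ.- + k) (begin
      + u ℤ.* + s ℤ.+ + ρ                                ≡⟨ e₁ (+ u) (+ s) (+ ρ) (+ n) (+ k) ⟩
      + u ℤ.* + s ℤ.+ (+ ρ ℤ.+ + k ℤ.* + n) ℤ.- + k ℤ.* + n ≡⟨ cong (λ v → + u ℤ.* + s ℤ.+ v ℤ.- + k ℤ.* + n) (pos-identity ρ k n u t (sym (m≡m%n+[m/n]*n (u * t) n))) ⟩
      + u ℤ.* + s ℤ.+ + u ℤ.* + t ℤ.- + k ℤ.* + n        ≡⟨ e₂ (+ u) (+ s) (+ t) (+ n) (+ k) ⟩
      + u ℤ.* + (s + t) ℤ.- + k ℤ.* + n                  ≡⟨ cong (λ v → + u ℤ.* + v ℤ.- + k ℤ.* + n) s+t≡n ⟩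
      + u ℤ.* + n ℤ.- + k ℤ.* + n                        ≡⟨ e₃ (+ u) (+ n) (+ k) ⟩
      (+ u ℤ.- + k) ℤ.* + n                              ∎)
      where
      open ≡-Reasoning
      k = (u * t) / n
      e₁ : ∀ u s ρ n k → u ℤ.* s ℤ.+ ρ ≡ u ℤ.* s ℤ.+ (ρ ℤ.+ k ℤ.* n) ℤ.- k ℤ.* n
      e₁ = ℤ.solve-∀
      e₂ : ∀ u s t n k → u ℤ.* s ℤ.+ u ℤ.* t ℤ.- k ℤ.* n ≡ u ℤ.* (s ℤ.+ t) ℤ.- k ℤ.* n
      e₂ = ℤ.solve-∀
      e₃ : ∀ u n k → u ℤ.* n ℤ.- k ℤ.* n ≡ (u ℤ.- k) ℤ.* n
      e₃ = ℤ.solve-∀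

  -- Since t ≡ -s modulo `n`, `ρ` is the residue of -us. Passing from `u` to `suc u` adds t = n - s
  -- > 0: if ρ < s the sum stays below `n` and is an ascent, and otherwise it wraps round to ρ - s ≤
  -- ρ.
  ascent⇔ : ((u * (n ∸ s)) % n < (suc u * (n ∸ s)) % n) ⇔ (∃[ r ] r < s × + n ℤ.∣ + u ℤ.* + s ℤ.+ + r)
  ascent⇔ = mk⇔ to from
    where
    to : ρ < (suc u * t) % n → ∃[ r ] r < s × + n ℤ.∣ + u ℤ.* + s ℤ.+ + r
    to ρ<σ = ρ , ≰⇒> s≰ρ , n∣us+ρ
      where
      s≰ρ : ¬ s ≤ ρ
      s≰ρ s≤ρ with m≤n⇒∃[o]m+o≡n s≤ρ
      ... | w , s+w≡ρ = <⇒≱ ρ<σ (begin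
        (suc u * t) % n        ≡⟨ step ⟩
        (t + ρ) % n            ≡⟨ cong (λ v → (t + v) % n) s+w≡ρ ⟨
        (t + (s + w)) % n      ≡⟨ cong (_% n) (e t s w) ⟩
        (w + 1 * (s + t)) % n  ≡⟨ cong (λ v → (w + 1 * v) % n) s+t≡n ⟩
        (w + 1 * n) % n        ≡⟨ [m+kn]%n≡m%n w 1 n ⟩
        w % n                  ≡⟨ m<n⇒m%n≡m (≤-<-trans w≤ρ (m%n<n (u * t) n)) ⟩
        w                      ≤⟨ w≤ρ ⟩
        ρ                      ∎)
        where
        open ≤-Reasoning
        w≤ρ = ≤-trans (m≤n+m w s) (≤-reflexive s+w≡ρ)
        e : ∀ t s w → t + (s + w) ≡ w + 1 * (s + t)
        e = solve-∀
    from : (∃[ r ] r < s × + n ℤ.∣ + u ℤ.* + s ℤ.+ + r) → ρ < (suc u * t) % n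
    from (r , r<s , n∣us+r) = subst (ρ <_) (sym (trans step (m<n⇒m%n≡m t+ρ<n))) (m<n+m ρ (m<n⇒0<n∸m s<n))
      where
      e : ∀ v r ρ → (v ℤ.+ r) ℤ.- (v ℤ.+ ρ) ≡ r ℤ.- ρ
      e = ℤ.solve-∀
      r≡ρ : r ≡ ρ
      r≡ρ = residue-unique (<-trans r<s s<n) (m%n<n (u * t) n)
        (∣-resp (e (+ u ℤ.* + s) (+ r) (+ ρ)) (ℤ.∣m∣n⇒∣m-n n∣us+r n∣us+ρ))
      t+ρ<n : t + ρ < n
      t+ρ<n = subst (t + ρ <_) (trans (+-comm t s) s+t≡n) (+-monoʳ-< t (subst (_< s) r≡ρ r<s))

if⌊⌋≡⇔ : ∀ {P : Set} {c} → c ≢ z → (P? : Dec P) → ((if ⌊ P? ⌋ then c else z) ≡ c) ⇔ P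
if⌊⌋≡⇔ c≢z (yes p) = mk⇔ (λ _ → p) (λ _ → refl)
if⌊⌋≡⇔ c≢z (no ¬p) = mk⇔ (λ z≡c → contradiction (sym z≡c) c≢z) (λ p → contradiction p ¬p)

-- The congruence depends on `x` only modulo `n`, so the criterion for a position inside the word
-- extends to its periodic repetition.
C-occurrence⇔ : ∀ {c n s} .{{_ : NonZero n}} → c ≢ z → s < n → ∀ x →
  (positions c (C c n s) +[ n ]ℤ) x ⇔ (∃[ r ] r < s × + n ℤ.∣ x ℤ.* + s ℤ.+ + r)
C-occurrence⇔ {c} {n} {s} c≢z s<n x = mk⇔ to from
  where
  lookup-C⇔ : ∀ i → (Vec.lookup (C c n s) i ≡ c) ⇔ (∃[ r ] r < s × + n ℤ.∣ + toℕ i ℤ.* + s ℤ.+ + r)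
  lookup-C⇔ i = ⇔-trans
    (mk⇔ (trans (sym (lookup∘tabulate _ i))) (trans (lookup∘tabulate _ i)))
    (⇔-trans (if⌊⌋≡⇔ c≢z _) (ascent⇔ n s ⦃ Fin.nonZeroIndex i ⦄ s<n (toℕ i)))
  to : (positions c (C c n s) +[ n ]ℤ) x → ∃[ r ] r < s × + n ℤ.∣ x ℤ.* + s ℤ.+ + r
  to (_ , (i , Ci≡c , refl) , j , refl) with Equivalence.to (lookup-C⇔ i) Ci≡c
  ... | r , r<s , h = r , r<s , ∣-resp (e (+ toℕ i) j (+ s) (+ r) (+ n)) (ℤ.∣m∣n⇒∣m+n h (ℤ.∣n⇒∣m*n (j ℤ.* + s) ℤ.∣-refl))
    where
    e : ∀ i j s r n → (i ℤ.* s ℤ.+ r) ℤ.+ j ℤ.* s ℤ.* n ≡ (i ℤ.+ n ℤ.* j) ℤ.* s ℤ.+ r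
    e = ℤ.solve-∀
  from : (∃[ r ] r < s × + n ℤ.∣ x ℤ.* + s ℤ.+ + r) → (positions c (C c n s) +[ n ]ℤ) x
  from (r , r<s , h) =
    + toℕ i , (i , Equivalence.from (lookup-C⇔ i) (r , r<s , n∣is+r) , refl) , x ℤ./ℕ n ,
    trans x≡ (cong (λ v → + toℕ i ℤ.+ v) (ℤ.*-comm (x ℤ./ℕ n) (+ n)))
    where
    x%n<n = ℤ.n%ℕd<d x n
    i = fromℕ< x%n<n
    x≡ : x ≡ + toℕ i ℤ.+ (x ℤ./ℕ n) ℤ.* + n
    x≡ = trans (ℤ.a≡a%ℕn+[a/ℕn]*n x n) (cong (λ v → + v ℤ.+ (x ℤ./ℕ n) ℤ.* + n) (sym (toℕ-fromℕ< x%n<n)))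
    e : ∀ i j s r n → ((i ℤ.+ j ℤ.* n) ℤ.* s ℤ.+ r) ℤ.- j ℤ.* s ℤ.* n ≡ i ℤ.* s ℤ.+ r
    e = ℤ.solve-∀
    n∣is+r : + n ℤ.∣ + toℕ i ℤ.* + s ℤ.+ + r
    n∣is+r = ∣-resp (e (+ toℕ i) (x ℤ./ℕ n) (+ s) (+ r) (+ n))
      (ℤ.∣m∣n⇒∣m-n (∣-resp (cong (λ v → v ℤ.* + s ℤ.+ + r) x≡) h) (ℤ.∣n⇒∣m*n ((x ℤ./ℕ n) ℤ.* + s) ℤ.∣-refl))

lookup-∷ʳ-inject₁ : ∀ {A : Set} {n} (w : Vec.Vec A n) c i → Vec.lookup (w ∷ʳ c) (Fin.inject₁ i) ≡ Vec.lookup w i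
lookup-∷ʳ-inject₁ (_ ∷ w) c Fin.zero    = refl
lookup-∷ʳ-inject₁ (_ ∷ w) c (Fin.suc i) = lookup-∷ʳ-inject₁ w c i

lookup-∷ʳ-fromℕ : ∀ {A : Set} {n} (w : Vec.Vec A n) c → Vec.lookup (w ∷ʳ c) (Fin.fromℕ n) ≡ c
lookup-∷ʳ-fromℕ []      c = refl
lookup-∷ʳ-fromℕ (_ ∷ w) c = lookup-∷ʳ-fromℕ w c

γ-occurrence⇔ : ∀ {m} c (w : Word m) x →
  (positions c (γ w) +[ m ]ℤ) x ⇔ (positions c w +[ m ]ℤ) (x ℤ.+ + 1)
γ-occurrence⇔ c [] x = mk⇔ (λ { (_ , (() , _) , _) }) (λ { (_ , (() , _) , _) })
γ-occurrence⇔ {suc m} c (l ∷ w) x = mk⇔ to from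
  where
  to : (positions c (w ∷ʳ l) +[ suc m ]ℤ) x → (positions c (l ∷ w) +[ suc m ]ℤ) (x ℤ.+ + 1)
  to (_ , (i , wi≡c , refl) , j , refl) with view i
  -- The rotated-away first letter now stands last; the place after it is position 0 of the next
  -- period, hence `j ℤ.+ + 1`.
  ... | ‵fromℕ     = + 0 , (Fin.zero , trans (sym (lookup-∷ʳ-fromℕ w l)) wi≡c , refl) , j ℤ.+ + 1 ,
    trans (cong (λ v → + v ℤ.+ + suc m ℤ.* j ℤ.+ + 1) (Fin.toℕ-fromℕ m)) (e (+ m) j)
    where
    e : ∀ m j → m ℤ.+ (+ 1 ℤ.+ m) ℤ.* j ℤ.+ + 1 ≡ + 0 ℤ.+ (+ 1 ℤ.+ m) ℤ.* (j ℤ.+ + 1)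
    e = ℤ.solve-∀
  ... | ‵inject₁ i′ = + suc (toℕ i′) , (Fin.suc i′ , trans (sym (lookup-∷ʳ-inject₁ w l i′)) wi≡c , refl) , j ,
    trans (cong (λ v → + v ℤ.+ + suc m ℤ.* j ℤ.+ + 1) (Fin.toℕ-inject₁ i′)) (e (+ toℕ i′) (+ suc m ℤ.* j))
    where
    e : ∀ i v → i ℤ.+ v ℤ.+ + 1 ≡ (+ 1 ℤ.+ i) ℤ.+ v
    e = ℤ.solve-∀
  e⁻ : ∀ x → x ≡ x ℤ.+ + 1 ℤ.- + 1
  e⁻ = ℤ.solve-∀
  from : (positions c (l ∷ w) +[ suc m ]ℤ) (x ℤ.+ + 1) → (positions c (w ∷ʳ l) +[ suc m ]ℤ) x
  from (_ , (Fin.zero , l≡c , refl) , j , x+1≡) =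
    + toℕ (Fin.fromℕ m) , (Fin.fromℕ m , trans (lookup-∷ʳ-fromℕ w l) l≡c , refl) , j ℤ.- + 1 ,
    trans (trans (e⁻ x) (trans (cong (ℤ._- + 1) x+1≡) (e (+ m) j)))
      (cong (λ v → + v ℤ.+ + suc m ℤ.* (j ℤ.- + 1)) (sym (Fin.toℕ-fromℕ m)))
    where
    e : ∀ m j → + 0 ℤ.+ (+ 1 ℤ.+ m) ℤ.* j ℤ.- + 1 ≡ m ℤ.+ (+ 1 ℤ.+ m) ℤ.* (j ℤ.- + 1)
    e = ℤ.solve-∀
  from (_ , (Fin.suc i , wi≡c , refl) , j , x+1≡) =
    + toℕ (Fin.inject₁ i) , (Fin.inject₁ i , trans (lookup-∷ʳ-inject₁ w l i) wi≡c , refl) , j ,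
    trans (trans (e⁻ x) (trans (cong (ℤ._- + 1) x+1≡) (e (+ toℕ i) (+ suc m ℤ.* j))))
      (cong (λ v → + v ℤ.+ + suc m ℤ.* j) (sym (Fin.toℕ-inject₁ i)))
    where
    e : ∀ i v → (+ 1 ℤ.+ i) ℤ.+ v ℤ.- + 1 ≡ i ℤ.+ v
    e = ℤ.solve-∀

γ^-occurrence⇔ : ∀ {m} c k (w : Word m) x →
  (positions c (γ^ k w) +[ m ]ℤ) x ⇔ (positions c w +[ m ]ℤ) (x ℤ.+ + k)
γ^-occurrence⇔ {m} c zero w x =
  subst (λ y → (positions c w +[ m ]ℤ) x ⇔ (positions c w +[ m ]ℤ) y) (sym (ℤ.+-identityʳ x)) ⇔-refl
γ^-occurrence⇔ {m} c (suc k) w x = ⇔-trans (γ-occurrence⇔ c (γ^ k w) x)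
  (subst (λ y → (positions c (γ^ k w) +[ m ]ℤ) (x ℤ.+ + 1) ⇔ (positions c w +[ m ]ℤ) y)
    (ℤ.+-assoc x (+ 1) (+ k)) (γ^-occurrence⇔ c k w (x ℤ.+ + 1)))

-- Clashes of two Christoffel words, read modulo the gcd of their lengths

module _ {m n s t : ℕ} .{{_ : NonZero m}} .{{_ : NonZero n}} (n⊥s : Coprime n s) (m⊥t : Coprime m t) where
  private
    p = gcd m n
    p∣m : + p ℤ.∣ + m
    p∣m = ℤ.∣ᵤ⇒∣ (gcd[m,n]∣m m n)
    p∣n : + p ℤ.∣ + n
    p∣n = ℤ.∣ᵤ⇒∣ (gcd[m,n]∣n m n)

  -- Forwards, `x` is eliminated: modulo `p`, subtract `t` times the first congruence from `s` times
  -- the second. Backwards, the two congruences are solved separately and glued by the Chinese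
  -- remainder theorem; the compatibility this needs follows by cancelling `s` and `t`, both prime
  -- to `p`.
  common-occurrence⇔ : ∀ k →
    (∃[ x ] (∃[ r ] r < s × + n ℤ.∣ x ℤ.* + s ℤ.+ + r) × (∃[ r′ ] r′ < t × + m ℤ.∣ (x ℤ.+ + k) ℤ.* + t ℤ.+ + r′)) ⇔
    (∃[ r ] ∃[ r′ ] r < s × r′ < t × + p ℤ.∣ + k ℤ.* (+ s ℤ.* + t) ℤ.+ + r′ ℤ.* + s ℤ.- + r ℤ.* + t)
  common-occurrence⇔ k = mk⇔ to from
    where
    to : (∃[ x ] (∃[ r ] r < s × + n ℤ.∣ x ℤ.* + s ℤ.+ + r) × (∃[ r′ ] r′ < t × + m ℤ.∣ (x ℤ.+ + k) ℤ.* + t ℤ.+ + r′)) →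
      ∃[ r ] ∃[ r′ ] r < s × r′ < t × + p ℤ.∣ + k ℤ.* (+ s ℤ.* + t) ℤ.+ + r′ ℤ.* + s ℤ.- + r ℤ.* + t
    to (x , (r , r<s , n∣) , (r′ , r′<t , m∣)) = r , r′ , r<s , r′<t ,
      ∣-resp (e x (+ k) (+ s) (+ t) (+ r) (+ r′))
        (ℤ.∣m∣n⇒∣m-n (ℤ.∣m⇒∣m*n (+ s) (ℤ.∣-trans p∣m m∣)) (ℤ.∣m⇒∣m*n (+ t) (ℤ.∣-trans p∣n n∣)))
      where
      e : ∀ x k s t r r′ → ((x ℤ.+ k) ℤ.* t ℤ.+ r′) ℤ.* s ℤ.- (x ℤ.* s ℤ.+ r) ℤ.* t ≡ k ℤ.* (s ℤ.* t) ℤ.+ r′ ℤ.* s ℤ.- r ℤ.* t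
      e = ℤ.solve-∀
    p⊥s : Coprime p s
    p⊥s = coprime-∣ (gcd[m,n]∣n m n) ∣-refl n⊥s
    p⊥t : Coprime p t
    p⊥t = coprime-∣ (gcd[m,n]∣m m n) ∣-refl m⊥t
    e₀ : ∀ x y k s t r r′ →
      (y ℤ.* t ℤ.- ℤ.- r′) ℤ.* s ℤ.- (x ℤ.* s ℤ.- ℤ.- r) ℤ.* t ℤ.- (k ℤ.* (s ℤ.* t) ℤ.+ r′ ℤ.* s ℤ.- r ℤ.* t)
      ≡ ((y ℤ.- k) ℤ.- x) ℤ.* s ℤ.* t
    e₀ = ℤ.solve-∀
    e₁ : ∀ w x s r → (w ℤ.- x) ℤ.* s ℤ.+ (x ℤ.* s ℤ.- ℤ.- r) ≡ w ℤ.* s ℤ.+ r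
    e₁ = ℤ.solve-∀
    e₂ : ∀ w y k → w ℤ.- (y ℤ.- k) ≡ (w ℤ.+ k) ℤ.- y
    e₂ = ℤ.solve-∀
    p∣diff : ∀ x y r r′ → + n ℤ.∣ x ℤ.* + s ℤ.- ℤ.- r → + m ℤ.∣ y ℤ.* + t ℤ.- ℤ.- r′ →
      + p ℤ.∣ + k ℤ.* (+ s ℤ.* + t) ℤ.+ r′ ℤ.* + s ℤ.- r ℤ.* + t →
      + p ℤ.∣ (y ℤ.- + k) ℤ.- x
    p∣diff x y r r′ n∣ m∣ p∣ = ∣-cancelʳ p⊥s _ (∣-cancelʳ p⊥t _ (∣-resp (e₀ x y (+ k) (+ s) (+ t) r r′)
      (ℤ.∣m∣n⇒∣m-n (ℤ.∣m∣n⇒∣m-n (ℤ.∣m⇒∣m*n (+ s) (ℤ.∣-trans p∣m m∣)) (ℤ.∣m⇒∣m*n (+ t) (ℤ.∣-trans p∣n n∣))) p∣)))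
    shift : ∀ {n} w x s r → + n ℤ.∣ w ℤ.- x → + n ℤ.∣ x ℤ.* s ℤ.- ℤ.- r → + n ℤ.∣ w ℤ.* s ℤ.+ r
    shift w x s r h h′ = ∣-resp (e₁ w x s r) (ℤ.∣m∣n⇒∣m+n (ℤ.∣m⇒∣m*n s h) h′)
    from : (∃[ r ] ∃[ r′ ] r < s × r′ < t × + p ℤ.∣ + k ℤ.* (+ s ℤ.* + t) ℤ.+ + r′ ℤ.* + s ℤ.- + r ℤ.* + t) →
      ∃[ x ] (∃[ r ] r < s × + n ℤ.∣ x ℤ.* + s ℤ.+ + r) × (∃[ r′ ] r′ < t × + m ℤ.∣ (x ℤ.+ + k) ℤ.* + t ℤ.+ + r′)
    from (r , r′ , r<s , r′<t , p∣) =
      -- Here `y` solves the congruence for x + k rather than for x, so the residues to be glued are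
      -- y - k modulo `m` and x modulo `n`.
      let x , _ , n∣ = solve-congruence n⊥s (ℤ.- + r)
          y , _ , m∣ = solve-congruence m⊥t (ℤ.- + r′)
          w , m∣′ , n∣′ = chinese-remainder m n (+ y ℤ.- + k) (+ x) (p∣diff (+ x) (+ y) (+ r) (+ r′) n∣ m∣ p∣)
      in w
        , (r , r<s , shift w (+ x) (+ s) (+ r) n∣′ n∣)
        , (r′ , r′<t , shift (w ℤ.+ + k) (+ y) (+ t) (+ r′) (∣-resp (e₂ w (+ y) (+ k)) m∣′) m∣)

  C-superimposable⇔ : s < n → t < m → ∀ k →
    PerfectlySuperimposable (C a n s) (γ^ k (C b m t)) ⇔
    (¬ (∃[ x ] (∃[ r ] r < s × + n ℤ.∣ x ℤ.* + s ℤ.+ + r) × (∃[ r′ ] r′ < t × + m ℤ.∣ (x ℤ.+ + k) ℤ.* + t ℤ.+ + r′)))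
  C-superimposable⇔ s<n t<m k = mk⇔
    (λ empty (x , in-a , in-b) → empty x (Equivalence.from (occ-a x) in-a , Equivalence.from (occ-b x) in-b))
    (λ ¬clash x (in-a , in-b) → ¬clash (x , Equivalence.to (occ-a x) in-a , Equivalence.to (occ-b x) in-b))
    where
    occ-a : ∀ x → (positions a (C a n s) +[ n ]ℤ) x ⇔ (∃[ r ] r < s × + n ℤ.∣ x ℤ.* + s ℤ.+ + r)
    occ-a = C-occurrence⇔ {a} {n} {s} (λ ()) s<n
    occ-b : ∀ x → (positions b (γ^ k (C b m t)) +[ m ]ℤ) x ⇔
      (∃[ r′ ] r′ < t × + m ℤ.∣ (x ℤ.+ + k) ℤ.* + t ℤ.+ + r′)
    occ-b x = ⇔-trans (γ^-occurrence⇔ b k (C b m t) x) (C-occurrence⇔ {b} {m} {t} (λ ()) t<m (x ℤ.+ + k))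

  superimposable⇔ : s < n → t < m → ∀ k →
    PerfectlySuperimposable (C a n s) (γ^ k (C b m t)) ⇔
    (¬ (∃[ r ] ∃[ r′ ] r < s × r′ < t × + p ℤ.∣ + k ℤ.* (+ s ℤ.* + t) ℤ.+ + r′ ℤ.* + s ℤ.- + r ℤ.* + t))
  superimposable⇔ s<n t<m k = ⇔-trans (C-superimposable⇔ s<n t<m k) (¬-cong-⇔ (common-occurrence⇔ k))

-- Hit and unhit residues; throughout, q = q′ + 1

module _ {α β : ℕ} (q′ : ℕ) .{{_ : NonZero α}} .{{_ : NonZero β}} (α⊥β : Coprime α β) where

  private opaque
    solve-below : ∀ d → ∃[ j ] j < α ×
      ((∃[ c ] (q′ * α + j) * β ≡ d + c * α) ⊎ (∃[ c ] d ≡ (q′ * α + j) * β + suc c * α))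
    solve-below d = let j , j<α , h = solve-congruence α⊥β (+ d) in j , j<α , ∣-diff⇒≡+* ((q′ * α + j) * β) d (lift j h)
      where
      e : ∀ q α β j d → (j ℤ.* β ℤ.- d) ℤ.+ q ℤ.* β ℤ.* α ≡ (q ℤ.* α ℤ.+ j) ℤ.* β ℤ.- d
      e = ℤ.solve-∀
      pos : ∀ j → (+ q′ ℤ.* + α ℤ.+ + j) ℤ.* + β ≡ + ((q′ * α + j) * β)
      pos j = trans (cong (λ v → (v ℤ.+ + j) ℤ.* + β) (sym (ℤ.pos-* q′ α))) (sym (ℤ.pos-* (q′ * α + j) β))
      lift : ∀ j → + α ℤ.∣ + j ℤ.* + β ℤ.- + d → + α ℤ.∣ + ((q′ * α + j) * β) ℤ.- + d
      lift j h = ∣-resp (trans (e (+ q′) (+ α) (+ β) (+ j) (+ d)) (cong (ℤ._- + d) (pos j)))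
        (ℤ.∣m∣n⇒∣m+n h (ℤ.∣n⇒∣m*n (+ q′ ℤ.* + β) ℤ.∣-refl))

    solve-above : ∀ d → ∃[ r ] r < α × α ∣ d + r * β
    solve-above d = let r , r<α , h = solve-congruence α⊥β (ℤ.- + d) in r , r<α , lift r h
      where
      e : ∀ u d → u ℤ.- ℤ.- d ≡ d ℤ.+ u
      e = ℤ.solve-∀
      lift : ∀ r → + α ℤ.∣ + r ℤ.* + β ℤ.- ℤ.- + d → α ∣ d + r * β
      lift r h = ℤ.∣⇒∣ᵤ (∣-resp (trans (e (+ r ℤ.* + β) (+ d)) (cong (λ v → + d ℤ.+ v) (sym (ℤ.pos-* r β)))) h)

  -- Take the largest r < qα with rβ ≡ d modulo `α`, namely r = q′α + j with j < α. If rβ ≥ d, the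
  -- difference is some r′α, and r′α ≤ rβ < qαβ forces r′ < qβ. Otherwise `d` exceeds rβ by a
  -- positive multiple of `α`.
  below-or-hit : ∀ d →
    (∃[ r ] ∃[ r′ ] r < suc q′ * α × r′ < suc q′ * β × d + r′ * α ≡ r * β) ⊎
    (∃[ i ] ∃[ j ] j < α × d ≡ q′ * α * β + suc i * α + j * β)
  below-or-hit d with solve-below d
  ... | j , j<α , inj₂ (i , refl) = inj₂ (i , j , j<α , e q′ α β j (suc i))
    where
    e : ∀ q α β j i → (q * α + j) * β + i * α ≡ q * α * β + i * α + j * β
    e = solve-∀
  ... | j , j<α , inj₁ (r′ , rβ≡) = inj₁ (q′ * α + j , r′ , r<qα , *-cancelʳ-< α r′ _ r′α<qβα , sym rβ≡)
    where
    e : ∀ q α β → q * α * β ≡ q * β * α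
    e = solve-∀
    r<qα : q′ * α + j < suc q′ * α
    r<qα = subst (_< suc q′ * α) (+-comm j (q′ * α)) (+-monoˡ-< (q′ * α) j<α)
    r′α<qβα : r′ * α < suc q′ * β * α
    r′α<qβα = begin-strict
      r′ * α            ≤⟨ m≤n+m _ d ⟩
      d + r′ * α        ≡⟨ rβ≡ ⟨
      (q′ * α + j) * β  <⟨ *-monoˡ-< β r<qα ⟩
      suc q′ * α * β    ≡⟨ e (suc q′) α β ⟩
      suc q′ * β * α    ∎
      where open ≤-Reasoning

  -- Take the smallest r with d + rβ divisible by `α`, so r < α, and let r′ be the quotient. If r′
  -- is not below qβ, write r′ = qβ + i and α - r = j + 1; then d = r′α - rβ takes the second form.
  above-or-hit : ∀ d →
    (∃[ r ] ∃[ r′ ] r < suc q′ * α × r′ < suc q′ * β × d + r * β ≡ r′ * α) ⊎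
    (∃[ i ] ∃[ j ] suc j ≤ α × d ≡ q′ * α * β + i * α + suc j * β)
  above-or-hit d with solve-above d
  ... | r , r<α , divides r′ d+rβ≡r′α with <-≤-connex r′ (suc q′ * β)
  ... | inj₁ r′<qβ = inj₁ (r , r′ , <-≤-trans r<α (m≤m+n α (q′ * α)) , r′<qβ , d+rβ≡r′α)
  ... | inj₂ qβ≤r′ with m≤n⇒∃[o]m+o≡n qβ≤r′ | m≤n⇒∃[o]m+o≡n r<α
  ... | i , refl | j , 1+r+j≡α = inj₂ (i , j , subst (suc j ≤_) (trans (e₁ j r) 1+r+j≡α) (m≤m+n (suc j) r) ,
    +-cancelʳ-≡ (r * β) _ _ (trans d+rβ≡r′α (trans (e₂ q′ α β i) (trans
      (cong (λ v → q′ * α * β + i * α + v * β) (sym 1+r+j≡α)) (e₃ (q′ * α * β + i * α) β r j)))))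
    where
    e₁ : ∀ j r → suc j + r ≡ suc r + j
    e₁ = solve-∀
    e₂ : ∀ q α β i → (suc q * β + i) * α ≡ q * α * β + i * α + α * β
    e₂ = solve-∀
    e₃ : ∀ u β r j → u + (suc r + j) * β ≡ u + suc j * β + r * β
    e₃ = solve-∀

-- The equation makes r - j a multiple cα with cβ = q′β + i + 1 > q′β, so c ≥ q and r ≥ qα. Neither
-- `i` nor `j` is bounded, so that a term r′α and multiples of p can be absorbed into them.
no-hit : ∀ {α β} q′ i j r .{{_ : NonZero α}} .{{_ : NonZero β}} → Coprime α β → r < suc q′ * α →
  q′ * α * β + suc i * α + j * β ≢ r * β
no-hit {α} {β} q′ i j r α⊥β r<qα eq
  with m≤n⇒∃[o]m+o≡n (*-cancelʳ-≤ j r β (≤-trans (m≤n+m (j * β) (q′ * α * β + suc i * α)) (≤-reflexive eq)))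
... | w , refl with coprime-divisor α⊥β (divides (q′ * β + suc i) βw≡)
  where
  e : ∀ q α β i j w → q * α * β + i * α + j * β ≡ (j + w) * β → β * w + j * β ≡ (q * β + i) * α + j * β
  e q α β i j w h = trans (e₁ β w j) (trans (sym h) (e₂ q α β i j))
    where
    e₁ : ∀ β w j → β * w + j * β ≡ (j + w) * β
    e₁ = solve-∀
    e₂ : ∀ q α β i j → q * α * β + i * α + j * β ≡ (q * β + i) * α + j * β
    e₂ = solve-∀
  βw≡ : β * w ≡ (q′ * β + suc i) * α
  βw≡ = +-cancelʳ-≡ (j * β) _ _ (e q′ α β (suc i) j w eq)
... | divides c refl = contradiction (<-≤-trans r<qα qα≤r) (<-irrefl refl)
  where
  e : ∀ q α β i j c → q * α * β + i * α + j * β ≡ (j + c * α) * β → (c * β) * α + j * β ≡ (q * β + i) * α + j * β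
  e q α β i j c h = trans (e₁ α β c j) (trans (sym h) (e₂ q α β i j))
    where
    e₁ : ∀ α β c j → (c * β) * α + j * β ≡ (j + c * α) * β
    e₁ = solve-∀
    e₂ : ∀ q α β i j → q * α * β + i * α + j * β ≡ (q * β + i) * α + j * β
    e₂ = solve-∀
  cβ≡ : c * β ≡ q′ * β + suc i
  cβ≡ = *-cancelʳ-≡ (c * β) _ α (+-cancelʳ-≡ (j * β) _ _ (e q′ α β (suc i) j c eq))
  q′<c : q′ < c
  q′<c = *-cancelʳ-< β q′ c (<-≤-trans (m<m+n (q′ * β) (s≤s z≤n)) (≤-reflexive (sym cβ≡)))
  qα≤r : suc q′ * α ≤ j + c * α
  qα≤r = ≤-trans (*-monoˡ-≤ α q′<c) (m≤n+m _ j)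

-- `α` divides (j′ - j)β, hence j′ - j, which is less than `α`.
normal-form-unique-≤ : ∀ {α β} .{{_ : NonZero α}} → Coprime α β → ∀ i j i′ j′ → j ≤ j′ → j′ < α →
  i * α + j * β ≡ i′ * α + j′ * β → i ≡ i′ × j ≡ j′
normal-form-unique-≤ {α} {β} α⊥β i j i′ j′ j≤j′ j′<α eq with m≤n⇒∃[o]m+o≡n j≤j′
... | w , refl with coprime-divisor α⊥β (∣m+n∣m⇒∣n (divides i βw≡) (n∣m*n i′))
  where
  e : ∀ u β j w → u + β * w + j * β ≡ u + (j + w) * β
  e = solve-∀
  βw≡ : i′ * α + β * w ≡ i * α
  βw≡ = +-cancelʳ-≡ (j * β) _ _ (trans (e (i′ * α) β j w) (sym eq))
... | divides zero refl = *-cancelʳ-≡ i i′ α (+-cancelʳ-≡ (j * β) _ _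
  (trans eq (cong (λ v → i′ * α + v * β) (+-identityʳ j)))) , sym (+-identityʳ j)
... | divides (suc c) refl = contradiction (≤-trans (m≤m+n α (c * α)) (m≤n+m _ j)) (<⇒≱ j′<α)

normal-form-unique : ∀ {α β} .{{_ : NonZero α}} → Coprime α β → ∀ i j i′ j′ → j < α → j′ < α →
  i * α + j * β ≡ i′ * α + j′ * β → i ≡ i′ × j ≡ j′
normal-form-unique α⊥β i j i′ j′ j<α j′<α eq with ≤-total j j′
... | inj₁ j≤j′ = normal-form-unique-≤ α⊥β i j i′ j′ j≤j′ j′<α eq
... | inj₂ j′≤j = let i′≡i , j′≡j = normal-form-unique-≤ α⊥β i′ j′ i j j′≤j j<α (sym eq) in sym i′≡i , sym j′≡j

-- Enumeration of the unhit residues by cells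

opaque
  ≡+*⇒∣-diff : ∀ {n} u v c → u ≡ v + c * n → + n ℤ.∣ + u ℤ.- + v
  ≡+*⇒∣-diff {n} u v c refl = ∣-resp (trans (e (+ v) (+ c ℤ.* + n)) (cong (λ w → + v ℤ.+ w ℤ.- + v) (sym (ℤ.pos-* c n))))
    (ℤ.∣n⇒∣m*n (+ c) ℤ.∣-refl)
    where
    e : ∀ v w → w ≡ v ℤ.+ w ℤ.- v
    e = ℤ.solve-∀

Hit : ℕ → ℕ → ℕ → ℕ → ℕ → Set
Hit p q α β d = ∃[ r ] ∃[ r′ ] r < q * α × r′ < q * β × + p ℤ.∣ + (d + r′ * α) ℤ.- + (r * β)

module Residues {α β : ℕ} (q′ x y : ℕ) .{{_ : NonZero α}} .{{_ : NonZero β}} (α⊥β : Coprime α β) (y≤α : y ≤ α) where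

  p : ℕ
  p = x * α + y * β + 2 * (q′ * α * β)

  -- The second block is empty for x ≤ β, which unites the two cases of the theorem.
  Cell : Set
  Cell = Fin x × Fin y ⊎ Fin (x ∸ β) × Fin (α ∸ y)

  row col residue : Cell → ℕ
  row (inj₁ (i , j)) = toℕ i
  row (inj₂ (i , j)) = toℕ i
  col (inj₁ (i , j)) = toℕ j
  col (inj₂ (i , j)) = y + toℕ j
  residue g = q′ * α * β + suc (row g) * α + col g * β

  col<α : ∀ g → col g < α
  col<α (inj₁ (i , j)) = <-≤-trans (toℕ<n j) y≤α
  col<α (inj₂ (i , j)) = <-≤-trans (+-monoʳ-< y (toℕ<n j)) (≤-reflexive (m+[n∸m]≡n y≤α))

  row-col-injective : ∀ g h → row g ≡ row h → col g ≡ col h → g ≡ h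
  row-col-injective (inj₁ (i , j)) (inj₁ (i′ , j′)) i≡ j≡ = cong₂ (λ i j → inj₁ (i , j)) (toℕ-injective i≡) (toℕ-injective j≡)
  row-col-injective (inj₁ (i , j)) (inj₂ (i′ , j′)) i≡ j≡ = contradiction (toℕ<n j) (≤⇒≯ (subst (y ≤_) (sym j≡) (m≤m+n y (toℕ j′))))
  row-col-injective (inj₂ (i , j)) (inj₁ (i′ , j′)) i≡ j≡ = contradiction (toℕ<n j′) (≤⇒≯ (subst (y ≤_) j≡ (m≤m+n y (toℕ j))))
  row-col-injective (inj₂ (i , j)) (inj₂ (i′ , j′)) i≡ j≡ =
    cong₂ (λ i j → inj₂ (i , j)) (toℕ-injective i≡) (toℕ-injective (+-cancelˡ-≡ y _ _ j≡))

  residue-injective : ∀ g h → residue g ≡ residue h → g ≡ h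
  residue-injective g h eq = row-col-injective g h (suc-injective (proj₁ unique)) (proj₂ unique)
    where
    unique = normal-form-unique α⊥β (suc (row g)) (col g) (suc (row h)) (col h) (col<α g) (col<α h)
      (+-cancelˡ-≡ (q′ * α * β) _ _ (trans (sym (+-assoc (q′ * α * β) _ _)) (trans eq (+-assoc (q′ * α * β) _ _))))

  -- In the first block the coefficients are completed to `x` and `y`. In the second they are
  -- completed to x - β and y + α, which gives the same sum because αβ can be counted as β copies of
  -- `α` or as α copies of `β`.
  complement : ∀ g → ∃[ i ] ∃[ j ] residue g + (q′ * α * β + i * α + suc j * β) ≡ p
  complement (inj₁ (i , j)) =
    let i′ , i+i′≡x = m≤n⇒∃[o]m+o≡n (toℕ<n i)
        j′ , j+j′≡y = m≤n⇒∃[o]m+o≡n (toℕ<n j)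
    in i′ , j′ , trans (e (q′ * α * β) α β (toℕ i) (toℕ j) i′ j′)
         (cong₂ (λ u v → u * α + v * β + 2 * (q′ * α * β)) i+i′≡x j+j′≡y)
    where
    e : ∀ Q α β i j i′ j′ → (Q + suc i * α + j * β) + (Q + i′ * α + suc j′ * β) ≡ (suc i + i′) * α + (suc j + j′) * β + 2 * Q
    e = solve-∀
  complement (inj₂ (i , j)) =
    let i′ , i+i′≡x∸β = m≤n⇒∃[o]m+o≡n (toℕ<n i)
        j′ , j+j′≡α∸y = m≤n⇒∃[o]m+o≡n (toℕ<n j)
        0<x∸β = ≤-trans (s≤s z≤n) (toℕ<n i)
    in i′ , y + j′ , (begin
      (Q + suc (toℕ i) * α + (y + toℕ j) * β) + (Q + i′ * α + suc (y + j′) * β) ≡⟨ e₁ Q α β y (toℕ i) (toℕ j) i′ j′ ⟩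
      (suc (toℕ i) + i′) * α + (y + (suc (toℕ j) + j′)) * β + y * β + 2 * Q
        ≡⟨ cong₂ (λ u v → u * α + (y + v) * β + y * β + 2 * Q) i+i′≡x∸β j+j′≡α∸y ⟩
      (x ∸ β) * α + (y + (α ∸ y)) * β + y * β + 2 * Q          ≡⟨ cong (λ v → (x ∸ β) * α + v * β + y * β + 2 * Q) (m+[n∸m]≡n y≤α) ⟩
      (x ∸ β) * α + α * β + y * β + 2 * Q                      ≡⟨ e₂ (x ∸ β) α β (y * β) (2 * Q) ⟩
      (x ∸ β + β) * α + (y * β + 2 * Q)                        ≡⟨ cong (λ v → v * α + (y * β + 2 * Q)) (m∸n+n≡m {x} {β} (<⇒≤ (m∸n≢0⇒n<m (m<n⇒n≢0 0<x∸β)))) ⟩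
      x * α + (y * β + 2 * Q)                                  ≡⟨ +-assoc (x * α) (y * β) (2 * Q) ⟨
      x * α + y * β + 2 * Q                                    ∎)
    where
    open ≡-Reasoning
    Q : ℕ
    Q = q′ * α * β
    e₁ : ∀ Q α β y i j i′ j′ → (Q + suc i * α + (y + j) * β) + (Q + i′ * α + suc (y + j′) * β) ≡ (suc i + i′) * α + (y + (suc j + j′)) * β + y * β + 2 * Q
    e₁ = solve-∀
    e₂ : ∀ u α β v w → u * α + α * β + v + w ≡ (u + β) * α + (v + w)
    e₂ = solve-∀

  residue<p : ∀ g → residue g < p
  residue<p g =
    let i , j , eq = complement g
        0<E = <-≤-trans (>-nonZero⁻¹ β) (≤-trans (m≤m+n β (j * β)) (m≤n+m (suc j * β) (q′ * α * β + i * α)))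
    in subst (residue g <_) eq (m<m+n (residue g) 0<E)

  -- A hit is an equation up to a multiple of `p` on one side; `no-hit` excludes both possibilities,
  -- the second after exchanging `α` and `β`.
  residue-unhit : ∀ g → ¬ Hit p (suc q′) α β (residue g)
  residue-unhit g (r , r′ , r<qα , r′<qβ , h) = go (∣-diff⇒≡+* (residue g + r′ * α) (r * β) h)
    where
    i = row g
    j = col g
    below : ∀ c → residue g + r′ * α + c * p ≢ r * β
    -- The multiple cp is split as c(x + 2q′β)α + cyβ.
    below c eq = no-hit q′ (i + r′ + c * (x + 2 * (q′ * β))) (j + c * y) r α⊥β r<qα
      (trans (e q′ α β i j r′ c x y) eq)
      where
      e : ∀ q α β i j r′ c x y →
        q * α * β + suc (i + r′ + c * (x + 2 * (q * β))) * α + (j + c * y) * β ≡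
        q * α * β + suc i * α + j * β + r′ * α + c * (x * α + y * β + 2 * (q * α * β))
      e = solve-∀
    above : ∀ c → residue g + r′ * α ≢ r * β + suc c * p
    above c eq with complement g
    -- One `p` is spent on replacing -residue by the complement; of the rest, 2Q is now counted
    -- among the multiples of `β`.
    ... | i′ , j′ , compl = no-hit q′ (j′ + r + c * (y + 2 * (q′ * α))) (i′ + c * x) r′ (Coprimality.sym α⊥β) r′<qβ
      (+-cancelˡ-≡ (residue g) _ _ (trans (e₁ (residue g) q′ α β i′ j′ r c x y)
        (trans (cong (λ v → r * β + (v + c * p)) compl) (sym eq))))
      where
      e₁ : ∀ R q α β i j r c x y →
        R + (q * β * α + suc (j + r + c * (y + 2 * (q * α))) * β + (i + c * x) * α) ≡
        r * β + (R + (q * α * β + i * α + suc j * β) + c * (x * α + y * β + 2 * (q * α * β)))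
      e₁ = solve-∀
    go : _ ⊎ _ → _
    go (inj₁ (zero , eq))  = below 0 (trans (+-identityʳ _) (trans eq (+-identityʳ (r * β))))
    go (inj₁ (suc c , eq)) = above c eq
    go (inj₂ (c , eq))     = below (suc c) (sym eq)


  -- Uniqueness of normal forms determines the coefficients. If j + j′ < α they agree directly,
  -- which gives the first block; otherwise α copies of `β` are first traded for β copies of `α`,
  -- which gives the second.
  locate : ∀ i j i′ j′ → j < α → suc j′ ≤ α → 1 ≤ y → (suc i + i′) * α + (j + suc j′) * β ≡ x * α + y * β →
    ∃[ g ] row g ≡ i × col g ≡ j
  locate i j i′ j′ j<α j′<α 1≤y eq with m≤n⇒∃[o]m+o≡n 1≤y
  -- One `β` is cancelled on both sides: y may equal α, but y′ = y - 1 is always below `α`, as a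
  -- normal form requires.
  ... | y′ , 1+y′≡y with <-≤-connex (j + j′) α
  ... | inj₁ j+j′<α = inj₁ (fromℕ< i<x , fromℕ< j<y) , toℕ-fromℕ< i<x , toℕ-fromℕ< j<y
    where
    e : ∀ u β j j′ → u + (j + suc j′) * β ≡ u + (j + j′) * β + β
    e = solve-∀
    e′ : ∀ u β y → u + suc y * β ≡ u + y * β + β
    e′ = solve-∀
    unique : suc i + i′ ≡ x × j + j′ ≡ y′
    unique = normal-form-unique α⊥β (suc i + i′) (j + j′) x y′ j+j′<α (subst (_≤ α) (sym 1+y′≡y) y≤α)
      (+-cancelʳ-≡ β _ _ (trans (sym (e ((suc i + i′) * α) β j j′)) (trans eq
        (trans (cong (λ v → x * α + v * β) (sym 1+y′≡y)) (e′ (x * α) β y′)))))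
    i<x : i < x
    i<x = subst (suc i ≤_) (proj₁ unique) (m≤m+n (suc i) i′)
    j<y : j < y
    j<y = subst (suc j ≤_) 1+y′≡y (s≤s (subst (j ≤_) (proj₂ unique) (m≤m+n j j′)))
  ... | inj₂ α≤j+j′ with m≤n⇒∃[o]m+o≡n α≤j+j′
  ... | w , α+w≡j+j′ with unique
    where
    e : ∀ u α β j j′ w → α + w ≡ j + j′ → u * α + (j + suc j′) * β ≡ (u + β) * α + w * β + β
    e u α β j j′ w h = trans (e₁ u α β j j′) (trans (cong (λ v → u * α + v * β + β) (sym h)) (e₂ u α β w))
      where
      e₁ : ∀ u α β j j′ → u * α + (j + suc j′) * β ≡ u * α + (j + j′) * β + β
      e₁ = solve-∀
      e₂ : ∀ u α β w → u * α + (α + w) * β + β ≡ (u + β) * α + w * β + β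
      e₂ = solve-∀
    e′ : ∀ u β y → u + suc y * β ≡ u + y * β + β
    e′ = solve-∀
    w<α : w < α
    w<α = +-cancelˡ-< α w α (<-≤-trans (≤-<-trans (≤-reflexive α+w≡j+j′) (+-mono-<-≤ j<α (<⇒≤ j′<α))) ≤-refl)
    unique : suc i + i′ + β ≡ x × w ≡ y′
    unique = normal-form-unique α⊥β (suc i + i′ + β) w x y′ w<α (subst (_≤ α) (sym 1+y′≡y) y≤α)
      (+-cancelʳ-≡ β _ _ (trans (sym (e (suc i + i′) α β j j′ w α+w≡j+j′)) (trans eq
        (trans (cong (λ v → x * α + v * β) (sym 1+y′≡y)) (e′ (x * α) β y′)))))
  ... | refl , refl with m≤n⇒∃[o]m+o≡n y≤j
    where
    -- Here α + y = j + (j′ + 1), and j′ + 1 ≤ α.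
    y≤j : y ≤ j
    y≤j = +-cancelˡ-≤ α _ _ (begin
      α + y         ≡⟨ cong (λ v → α + v) 1+y′≡y ⟨
      α + suc w     ≡⟨ +-suc α w ⟩
      suc (α + w)   ≡⟨ cong suc α+w≡j+j′ ⟩
      suc (j + j′)  ≡⟨ +-suc j j′ ⟨
      j + suc j′    ≤⟨ +-monoʳ-≤ j j′<α ⟩
      j + α         ≡⟨ +-comm j α ⟩
      α + j         ∎)
      where open ≤-Reasoning
  ... | o , refl = inj₂ (fromℕ< i<x∸β , fromℕ< o<α∸y) , toℕ-fromℕ< i<x∸β , cong (λ v → y + v) (toℕ-fromℕ< o<α∸y)
    where
    i<x∸β : i < x ∸ β
    i<x∸β = subst (suc i ≤_) (sym (m+n∸n≡m (suc i + i′) β)) (m≤m+n (suc i) i′)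
    o<α∸y : o < α ∸ y
    o<α∸y = +-cancelˡ-< y o (α ∸ y) (<-≤-trans j<α (≤-reflexive (sym (m+[n∸m]≡n y≤α))))

  -- Being unhit, `d` must have the form left by `below-or-hit`, and p - d the form left by
  -- `above-or-hit`. Adding the two and cancelling 2Q yields the equation that `locate` solves.
  unhit⇒residue : 1 ≤ y → ∀ d → d ≤ p → ¬ Hit p (suc q′) α β d → ∃[ g ] residue g ≡ d
  unhit⇒residue 1≤y d d≤p ¬hit with m≤n⇒∃[o]m+o≡n d≤p
  ... | d′ , d+d′≡p with below-or-hit q′ α⊥β d | above-or-hit q′ α⊥β d′
  ... | inj₁ (r , r′ , r<qα , r′<qβ , eq) | _ =
    contradiction (r , r′ , r<qα , r′<qβ , ≡+*⇒∣-diff (d + r′ * α) (r * β) 0 (trans eq (sym (+-identityʳ _)))) ¬hit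
  ... | inj₂ _ | inj₁ (r , r′ , r<qα , r′<qβ , eq) =
    contradiction (r , r′ , r<qα , r′<qβ , ≡+*⇒∣-diff (d + r′ * α) (r * β) 1 (begin
      d + r′ * α         ≡⟨ cong (λ v → d + v) eq ⟨
      d + (d′ + r * β)   ≡⟨ e d d′ (r * β) ⟩
      r * β + 1 * (d + d′) ≡⟨ cong (λ v → r * β + 1 * v) d+d′≡p ⟩
      r * β + 1 * p      ∎)) ¬hit
    where
    open ≡-Reasoning
    e : ∀ d d′ u → d + (d′ + u) ≡ u + 1 * (d + d′)
    e = solve-∀
  ... | inj₂ (i , j , j<α , refl) | inj₂ (i′ , j′ , j′<α , refl) =
    let g , row≡i , col≡j = locate i j i′ j′ j<α j′<α 1≤y
          (+-cancelʳ-≡ (2 * (q′ * α * β)) _ _ (trans (sym (e (q′ * α * β) α β i j i′ j′)) d+d′≡p))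
    in g , cong₂ (λ i j → q′ * α * β + suc i * α + j * β) row≡i col≡j
    where
    e : ∀ Q α β i j i′ j′ → (Q + suc i * α + j * β) + (Q + i′ * α + suc j′ * β) ≡ (suc i + i′) * α + (j + suc j′) * β + 2 * Q
    e = solve-∀

-- Congruences linking a shift to its residue

opaque
  -- The first expression is q times (kqαβ + r′α - rβ). The factor `q` cancels modulo `p`, and kqαβ
  -- may be replaced by `d`.
  ∣-rescale : ∀ {p q} α β k d r r′ → Coprime p q → + p ℤ.∣ + k ℤ.* + (q * α * β) ℤ.- + d →
    (+ p ℤ.∣ + k ℤ.* (+ (q * α) ℤ.* + (q * β)) ℤ.+ + r′ ℤ.* + (q * α) ℤ.- + r ℤ.* + (q * β)) ⇔
    (+ p ℤ.∣ + (d + r′ * α) ℤ.- + (r * β))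
  ∣-rescale {p} {q} α β k d r r′ p⊥q h = mk⇔
    (λ h₁ → ∣-resp (sym small) (∣-resp (e₂ (+ k ℤ.* + (q * α * β) ℤ.- + d) (+ d ℤ.+ + r′ ℤ.* + α ℤ.- + r ℤ.* + β))
      (ℤ.∣m∣n⇒∣m-n (∣-cancelʳ p⊥q ((+ k ℤ.* + (q * α * β) ℤ.- + d) ℤ.+ (+ d ℤ.+ + r′ ℤ.* + α ℤ.- + r ℤ.* + β)) (∣-resp big h₁)) h)))
    (λ h₂ → ∣-resp (sym big) (ℤ.∣m⇒∣m*n (+ q) (ℤ.∣m∣n⇒∣m+n h (∣-resp small h₂))))
    where
    big : + k ℤ.* (+ (q * α) ℤ.* + (q * β)) ℤ.+ + r′ ℤ.* + (q * α) ℤ.- + r ℤ.* + (q * β) ≡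
      ((+ k ℤ.* + (q * α * β) ℤ.- + d) ℤ.+ (+ d ℤ.+ + r′ ℤ.* + α ℤ.- + r ℤ.* + β)) ℤ.* + q
    big = trans (cong₂ (λ u v → + k ℤ.* (u ℤ.* v) ℤ.+ + r′ ℤ.* u ℤ.- + r ℤ.* v) (ℤ.pos-* q α) (ℤ.pos-* q β))
      (trans (e₁ (+ k) (+ q) (+ α) (+ β) (+ d) (+ r) (+ r′))
        (cong (λ u → ((+ k ℤ.* u ℤ.- + d) ℤ.+ (+ d ℤ.+ + r′ ℤ.* + α ℤ.- + r ℤ.* + β)) ℤ.* + q)
          (sym (trans (ℤ.pos-* (q * α) β) (cong (ℤ._* + β) (ℤ.pos-* q α))))))
      where
      e₁ : ∀ k q α β d r r′ → k ℤ.* ((q ℤ.* α) ℤ.* (q ℤ.* β)) ℤ.+ r′ ℤ.* (q ℤ.* α) ℤ.- r ℤ.* (q ℤ.* β) ≡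
        ((k ℤ.* (q ℤ.* α ℤ.* β) ℤ.- d) ℤ.+ (d ℤ.+ r′ ℤ.* α ℤ.- r ℤ.* β)) ℤ.* q
      e₁ = ℤ.solve-∀
    small : + (d + r′ * α) ℤ.- + (r * β) ≡ + d ℤ.+ + r′ ℤ.* + α ℤ.- + r ℤ.* + β
    small = cong₂ (λ u v → + d ℤ.+ u ℤ.- v) (ℤ.pos-* r′ α) (ℤ.pos-* r β)
    e₂ : ∀ u v → (u ℤ.+ v) ℤ.- u ≡ v
    e₂ = ℤ.solve-∀

  ∣-*-% : ∀ p .{{_ : NonZero p}} k l → + p ℤ.∣ + k ℤ.* + l ℤ.- + ((k * l) % p)
  ∣-*-% p k l = ∣-resp (cong (ℤ._- + ((k * l) % p)) (ℤ.pos-* k l))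
    (≡+*⇒∣-diff (k * l) ((k * l) % p) ((k * l) / p) (m≡m%n+[m/n]*n (k * l) p))

  ∣-+-multiple : ∀ p k c l d → + p ℤ.∣ + k ℤ.* + l ℤ.- d → + p ℤ.∣ + (k + c * p) ℤ.* + l ℤ.- d
  ∣-+-multiple p k c l d h = ∣-resp (trans (e (+ k) (+ c) (+ p) (+ l) d) (cong (λ u → (+ k ℤ.+ u) ℤ.* + l ℤ.- d) (sym (ℤ.pos-* c p))))
    (ℤ.∣m∣n⇒∣m+n h (ℤ.∣n⇒∣m*n (+ c ℤ.* + l) ℤ.∣-refl))
    where
    e : ∀ k c p l d → (k ℤ.* l ℤ.- d) ℤ.+ c ℤ.* l ℤ.* p ≡ (k ℤ.+ c ℤ.* p) ℤ.* l ℤ.- d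
    e = ℤ.solve-∀

  ∣-diff-multiplier : ∀ {p l} → Coprime p l → ∀ k k′ d →
    + p ℤ.∣ k ℤ.* + l ℤ.- d → + p ℤ.∣ k′ ℤ.* + l ℤ.- d → + p ℤ.∣ k ℤ.- k′
  ∣-diff-multiplier {p} {l} p⊥l k k′ d h h′ = ∣-cancelʳ p⊥l (k ℤ.- k′) (∣-resp (e k k′ (+ l) d) (ℤ.∣m∣n⇒∣m-n h h′))
    where
    e : ∀ k k′ l d → (k ℤ.* l ℤ.- d) ℤ.- (k′ ℤ.* l ℤ.- d) ≡ (k ℤ.- k′) ℤ.* l
    e = ℤ.solve-∀

  ∣-diff-trans : ∀ {p} u d d′ → + p ℤ.∣ u ℤ.- d → + p ℤ.∣ u ℤ.- d′ → + p ℤ.∣ d ℤ.- d′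
  ∣-diff-trans u d d′ h h′ = ∣-resp (e u d d′) (ℤ.∣m∣n⇒∣m-n h′ h)
    where
    e : ∀ u d d′ → (u ℤ.- d′) ℤ.- (u ℤ.- d) ≡ d ℤ.- d′
    e = ℤ.solve-∀

-- Counting

lookup-injective : ∀ {A : Set} {xs : List A} → Unique xs → ∀ i j → lookup xs i ≡ lookup xs j → i ≡ j
lookup-injective (_ ∷ _)    Fin.zero    Fin.zero    _  = refl
lookup-injective (x∉ ∷ _)   Fin.zero    (Fin.suc j) eq = contradiction eq (All.lookup x∉ (∈-lookup j))
lookup-injective (x∉ ∷ _)   (Fin.suc i) Fin.zero    eq = contradiction (sym eq) (All.lookup x∉ (∈-lookup i))
lookup-injective (_ ∷ xs!)  (Fin.suc i) (Fin.suc j) eq = cong Fin.suc (lookup-injective xs! i j eq)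

-- A bijection given as a relation, so that neither direction has to be inverted explicitly.
-- Choosing related elements gives injections both ways between `Fin (length xs)` and `Fin N`;
-- uniqueness in `xs` makes equal entries have equal indices.
length-correspondence : ∀ {A B : Set} {N} {xs : List A} → Unique xs → Fin N ↔ B → (R : A → B → Set) →
  (∀ {x} → x ∈ xs → ∃[ y ] R x y) → (∀ y → ∃[ x ] x ∈ xs × R x y) →
  (∀ x x′ y → R x y → R x′ y → x ≡ x′) → (∀ x y y′ → R x y → R x y′ → y ≡ y′) →
  length xs ≡ N
length-correspondence {A} {B} {N} {xs} xs! iso R image preimage R-injective R-functional =
  ≤-antisym (injective⇒≤ {f = f} f-injective) (injective⇒≤ {f = g} g-injective)
  where
  open Inverse iso using (to; from; strictlyInverseˡ; strictlyInverseʳ)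
  f : Fin (length xs) → Fin N
  f i = from (proj₁ (image (∈-lookup {xs = xs} i)))
  g : Fin N → Fin (length xs)
  g j = Any.index (proj₁ (proj₂ (preimage (to j))))
  f-injective : ∀ {i i′} → f i ≡ f i′ → i ≡ i′
  f-injective {i} {i′} eq = lookup-injective xs! i i′ (R-injective _ _ _ (proj₂ (image (∈-lookup i)))
    (subst (R (lookup xs i′)) (trans (sym (strictlyInverseˡ _)) (trans (cong to (sym eq)) (strictlyInverseˡ _)))
      (proj₂ (image (∈-lookup i′)))))
  lookup-g : ∀ j → proj₁ (preimage (to j)) ≡ lookup xs (g j)
  lookup-g j = Any.lookup-index (proj₁ (proj₂ (preimage (to j))))
  g-injective : ∀ {j j′} → g j ≡ g j′ → j ≡ j′
  g-injective {j} {j′} eq = trans (sym (strictlyInverseʳ j)) (trans (cong from to≡) (strictlyInverseʳ j′))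
    where
    to≡ : to j ≡ to j′
    to≡ = R-functional _ _ _ (subst (λ x → R x (to j)) (trans (lookup-g j) (trans (cong (lookup xs) eq) (sym (lookup-g j′))))
      (proj₂ (proj₂ (preimage (to j))))) (proj₂ (proj₂ (preimage (to j′))))

module _ {α β q′ x y : ℕ} .{{_ : NonZero α}} .{{_ : NonZero β}} (α⊥β : Coprime α β) (1≤y : 1 ≤ y) (y≤α : y ≤ α) where
  open Residues q′ x y α⊥β y≤α

  private
    q Λ : ℕ
    q = suc q′
    Λ = q * α * β

    indexing : ∀ M → Fin (M * (x * y + (x ∸ β) * (α ∸ y))) ↔ (Fin M × Cell)
    indexing M = (↔-id (Fin M) ×-↔ ((*↔× ⊎-↔ *↔×) ↔-∘ +↔⊎)) ↔-∘ *↔×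

  -- The shifts below `m` form m/p blocks of length `p`. As `Λ` is invertible modulo `p`, each
  -- residue is kΛ for exactly one `k` in each block, so good shifts correspond to pairs of a block
  -- and a cell. The variable `P`, later the gcd, lets matching on `refl` identify it with the
  -- expression `p`.
  count-unhit : ∀ m P .{{_ : NonZero P}} → P ≡ p → P ∣ m → Coprime P (q * α) → Coprime P (q * β) →
    {S : ℕ → Set} (S? : ∀ k → Dec (S k)) →
    (∀ k → S k ⇔ (¬ (∃[ r ] ∃[ r′ ] r < q * α × r′ < q * β ×
      + P ℤ.∣ + k ℤ.* (+ (q * α) ℤ.* + (q * β)) ℤ.+ + r′ ℤ.* + (q * α) ℤ.- + r ℤ.* + (q * β)))) →
    length (filter S? (upTo m)) ≡ (m / P) * (x * y + (x ∸ β) * (α ∸ y))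
  count-unhit m _ refl p∣m p⊥qα p⊥qβ {S} S? S⇔ =
    length-correspondence (Unique.filter⁺ S? (Unique.upTo⁺ m)) (indexing (m / p)) R
      image preimage R-injective R-functional
    where
    p⊥q : Coprime p q
    p⊥q = coprime-∣ ∣-refl (m∣m*n α) p⊥qα
    p⊥Λ : Coprime p Λ
    p⊥Λ = coprime-*ʳ p⊥qα (coprime-∣ ∣-refl (n∣m*n q) p⊥qβ)
    R : ℕ → Fin (m / p) × Cell → Set
    R k (c , g) = toℕ c ≡ k / p × + p ℤ.∣ + k ℤ.* + Λ ℤ.- + residue g
    S⇔unhit : ∀ k d → + p ℤ.∣ + k ℤ.* + Λ ℤ.- + d → S k ⇔ (¬ Hit p q α β d)
    S⇔unhit k d h = ⇔-trans (S⇔ k) (¬-cong-⇔ (mk⇔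
      (λ (r , r′ , r< , r′< , h₁) → r , r′ , r< , r′< , Equivalence.to (∣-rescale α β k d r r′ p⊥q h) h₁)
      (λ (r , r′ , r< , r′< , h₁) → r , r′ , r< , r′< , Equivalence.from (∣-rescale α β k d r r′ p⊥q h) h₁)))
    image : ∀ {k} → k ∈ filter S? (upTo m) → ∃[ cg ] R k cg
    image {k} k∈ =
      let k∈upTo , Sk = ∈-filter⁻ S? {xs = upTo m} k∈
          c<m/p = m<n*o⇒m/o<n {k} {m / p} {p} (subst (k <_) (sym (m/n*n≡m p∣m)) (∈-upTo⁻ k∈upTo))
          d = (k * Λ) % p
          g , res≡d = unhit⇒residue 1≤y d (<⇒≤ (m%n<n (k * Λ) p)) (Equivalence.to (S⇔unhit k d (∣-*-% p k Λ)) Sk)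
      in (fromℕ< c<m/p , g) , toℕ-fromℕ< c<m/p , subst (λ v → + p ℤ.∣ + k ℤ.* + Λ ℤ.- + v) (sym res≡d) (∣-*-% p k Λ)
    preimage : ∀ cg → ∃[ k ] k ∈ filter S? (upTo m) × R k cg
    preimage (c , g) =
      -- `κ` is the shift belonging to the cell in block 0; adding cp moves it to block c without
      -- changing its residue.
      let κ , κ<p , h = solve-congruence p⊥Λ (+ residue g)
          h′ = ∣-+-multiple p κ (toℕ c) Λ (+ residue g) h
      in κ + toℕ c * p ,
        ∈-filter⁺ S? (∈-upTo⁺ (bound κ κ<p)) (Equivalence.from (S⇔unhit (κ + toℕ c * p) (residue g) h′) (residue-unhit g)) ,
        sym (quotient κ κ<p) , h′
      where
      bound : ∀ κ → κ < p → κ + toℕ c * p < m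
      bound κ κ<p = <-≤-trans (+-monoˡ-< (toℕ c * p) κ<p) (≤-trans (*-monoˡ-≤ p (toℕ<n c)) (≤-reflexive (m/n*n≡m p∣m)))
      quotient : ∀ κ → κ < p → (κ + toℕ c * p) / p ≡ toℕ c
      quotient κ κ<p = trans (+-distrib-/-∣ʳ κ (divides-refl (toℕ c))) (cong₂ _+_ (m<n⇒m/n≡0 κ<p) (m*n/n≡m (toℕ c) p))
    /-+-multiple : ∀ k c → (k + c * p) / p ≡ k / p + c
    /-+-multiple k c = trans (+-distrib-/-∣ʳ k (divides-refl c)) (cong (λ v → k / p + v) (m*n/n≡m c p))
    -- Numbers congruent modulo `p` and lying in the same block are equal.
    ≡-from-/ : ∀ k k′ → k / p ≡ k′ / p →
      (∃[ c ] k ≡ k′ + c * p) ⊎ (∃[ c ] k′ ≡ k + suc c * p) → k ≡ k′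
    ≡-from-/ k k′ k/p≡ (inj₁ (c , refl)) with +-cancelˡ-≡ (k′ / p) c 0 (trans (sym (/-+-multiple k′ c)) (trans k/p≡ (sym (+-identityʳ _))))
    ... | refl = +-identityʳ k′
    ≡-from-/ k k′ k/p≡ (inj₂ (c , refl)) with +-cancelˡ-≡ (k / p) (suc c) 0 (trans (sym (/-+-multiple k (suc c))) (trans (sym k/p≡) (sym (+-identityʳ _))))
    ... | ()
    R-injective : ∀ k k′ cg → R k cg → R k′ cg → k ≡ k′
    R-injective k k′ (c , g) (c≡ , h) (c≡′ , h′) = ≡-from-/ k k′ (trans (sym c≡) c≡′)
      (∣-diff⇒≡+* k k′ (∣-diff-multiplier p⊥Λ (+ k) (+ k′) (+ residue g) h h′))
    R-functional : ∀ k cg cg′ → R k cg → R k cg′ → cg ≡ cg′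
    R-functional k (c , g) (c′ , g′) (c≡ , h) (c≡′ , h′) = cong₂ _,_ (toℕ-injective (trans c≡ (sym c≡′)))
      (residue-injective g g′ (residue-unique (residue<p g) (residue<p g′)
        (∣-diff-trans (+ k ℤ.* + Λ) (+ residue g) (+ residue g′) h h′)))

-- Closed formulas and the theorem

coprime-self⇒≡1 : ∀ {n} → Coprime n n → n ≡ 1
coprime-self⇒≡1 n⊥n = n⊥n (∣-refl , ∣-refl)

coprime-≤⇒< : ∀ {n s} → 1 < n → Coprime n s → s ≤ n → s < n
coprime-≤⇒< 1<n n⊥s s≤n = ≤∧≢⇒< s≤n λ { refl → contradiction (coprime-self⇒≡1 n⊥s) (>⇒≢ 1<n) }

opaque
  -- Moving the subtracted term to the other side leaves an equation of natural numbers, the form in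
  -- which `Residues` defines its `p`.
  gcd-equation : ∀ p q′ α β x y → + (x * α + y * β) ≡ + p ℤ.- + (2 * α * β) ℤ.* (+ suc q′ ℤ.- + 1) →
    p ≡ x * α + y * β + 2 * (q′ * α * β)
  gcd-equation p q′ α β x y eq = ℤ.+-injective (begin
    + p                                                       ≡⟨ e (+ p) (+ (2 * α * β)) (+ q′) ⟩
    (+ p ℤ.- + (2 * α * β) ℤ.* (+ suc q′ ℤ.- + 1)) ℤ.+ + (2 * α * β) ℤ.* + q′
      ≡⟨ cong₂ ℤ._+_ (sym eq) (sym (ℤ.pos-* (2 * α * β) q′)) ⟩
    + (x * α + y * β + 2 * α * β * q′)                        ≡⟨ cong (λ v → + (x * α + y * β + v)) (e′ α β q′) ⟩
    + (x * α + y * β + 2 * (q′ * α * β))                      ∎)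
    where
    open ≡-Reasoning
    e : ∀ p u q → p ≡ (p ℤ.- u ℤ.* (+ 1 ℤ.+ q ℤ.- + 1)) ℤ.+ u ℤ.* q
    e = ℤ.solve-∀
    e′ : ∀ α β q → 2 * α * β * q ≡ 2 * (q * α * β)
    e′ = solve-∀

  cells-x≤β : ∀ M x y α β → x ≤ β → M * (x * y + (x ∸ β) * (α ∸ y)) ≡ x * y * M
  cells-x≤β M x y α β x≤β =
    trans (cong (λ v → M * (x * y + v * (α ∸ y))) (m≤n⇒m∸n≡0 x≤β)) (e M (x * y))
    where
    e : ∀ M u → M * (u + 0) ≡ u * M
    e = solve-∀

  cells-β≤x : ∀ M x y α β → β ≤ x → y ≤ α →
    + (M * (x * y + (x ∸ β) * (α ∸ y))) ≡ (+ (x * α + y * β) ℤ.- + (α * β)) ℤ.* + M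
  cells-β≤x M x y α β β≤x y≤α = begin
    + (M * (x * y + (x ∸ β) * (α ∸ y)))             ≡⟨ cong +_ (*-comm M _) ⟩
    + ((x * y + (x ∸ β) * (α ∸ y)) * M)             ≡⟨ ℤ.pos-* (x * y + (x ∸ β) * (α ∸ y)) M ⟩
    + (x * y + (x ∸ β) * (α ∸ y)) ℤ.* + M           ≡⟨ cong (ℤ._* + M) (e₁ (+ (x * y + (x ∸ β) * (α ∸ y))) (+ (α * β))) ⟩
    (+ (x * y + (x ∸ β) * (α ∸ y) + α * β) ℤ.- + (α * β)) ℤ.* + M
      ≡⟨ cong (λ v → (+ v ℤ.- + (α * β)) ℤ.* + M)
           -- With x = β + d and α = y + f this is a polynomial identity in β, y, d, f. Only the
           -- free occurrences of x and α are rewritten; `x₀` and `α₀` protect those inside the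
           -- differences.
           (subst₂ (λ x α → x * y + (x₀ ∸ β) * (α₀ ∸ y) + α * β ≡ x * α + y * β)
             (m+[n∸m]≡n β≤x) (m+[n∸m]≡n y≤α) (e₂ β y (x ∸ β) (α ∸ y))) ⟩
    (+ (x * α + y * β) ℤ.- + (α * β)) ℤ.* + M       ∎
    where
    open ≡-Reasoning
    x₀ α₀ : ℕ
    x₀ = x
    α₀ = α
    e₁ : ∀ u v → u ≡ (u ℤ.+ v) ℤ.- v
    e₁ = ℤ.solve-∀
    e₂ : ∀ β y d f → (β + d) * y + d * f + (y + f) * β ≡ (β + d) * (y + f) + y * β
    e₂ = solve-∀

proposition4p3 :
  ∀ (m n q α β : ℕ) .{{_ : NonZero n}} → n < m → 1 ≤ q → 1 ≤ α → 1 ≤ β →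
  gcd α β ≡ 1 →
  q * α ≤ n → gcd n (q * α) ≡ 1 →
  q * β ≤ m → gcd m (q * β) ≡ 1 →
  Superimposable (C a n (q * α)) (C b m (q * β)) →
  let p = gcd m n
      instance _ = gcd-nonZero m n
      N = #superimpositions (C a n (q * α)) (C b m (q * β)) in
  ∀ (x y : ℕ) → 1 ≤ x → 1 ≤ y →
  + (x * α + y * β) ≡ + p ℤ.- + (2 * α * β) ℤ.* (+ q ℤ.- + 1) →
  y ≤ α →
  (x ≤ β → N ≡ x * y * (m / p)) ×
  (x > β → + N ≡ (+ (x * α + y * β) ℤ.- + (α * β)) ℤ.* + (m / p))
proposition4p3 m n (suc q′) α β n<m (s≤s z≤n) 1≤α 1≤β gcd≡1 qα≤n gcd[n,qα]≡1 qβ≤m gcd[m,qβ]≡1 _ x y 1≤x 1≤y equation y≤α =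
  (λ x≤β → trans count (cells-x≤β (m / p) x y α β x≤β)) ,
  (λ β<x → trans (cong +_ count) (cells-β≤x (m / p) x y α β (<⇒≤ β<x) y≤α))
  where
  instance
    α≢0 : NonZero α
    α≢0 = >-nonZero 1≤α
    β≢0 : NonZero β
    β≢0 = >-nonZero 1≤β
    m≢0 : NonZero m
    m≢0 = >-nonZero (≤-<-trans z≤n n<m)
    p≢0 : NonZero (gcd m n)
    p≢0 = gcd-nonZero m n
  q p : ℕ
  q = suc q′
  p = gcd m n
  p≡ : p ≡ x * α + y * β + 2 * (q′ * α * β)
  p≡ = gcd-equation p q′ α β x y equation
  n⊥qα : Coprime n (q * α)
  n⊥qα = gcd≡1⇒coprime gcd[n,qα]≡1
  m⊥qβ : Coprime m (q * β)
  m⊥qβ = gcd≡1⇒coprime gcd[m,qβ]≡1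
  1<p : 1 < p
  -- Both xα and yβ are at least 1. Thus `n` and `m`, being multiples of `p`, exceed 1, and
  -- coprimality makes qα < n and qβ < m strict.
  1<p = ≤-trans (≤-trans (+-mono-≤ (*-mono-≤ 1≤x 1≤α) (*-mono-≤ 1≤y 1≤β)) (m≤m+n _ (2 * (q′ * α * β)))) (≤-reflexive (sym p≡))
  1<n : 1 < n
  1<n = <-≤-trans 1<p (∣⇒≤ (gcd[m,n]∣n m n))
  1<m : 1 < m
  1<m = <-≤-trans 1<p (∣⇒≤ (gcd[m,n]∣m m n))
  count : #superimpositions (C a n (q * α)) (C b m (q * β)) ≡ (m / p) * (x * y + (x ∸ β) * (α ∸ y))
  count = count-unhit {q′ = q′} (gcd≡1⇒coprime gcd≡1) 1≤y y≤α m p p≡ (gcd[m,n]∣m m n)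
    (coprime-∣ (gcd[m,n]∣n m n) ∣-refl n⊥qα) (coprime-∣ (gcd[m,n]∣m m n) ∣-refl m⊥qβ)
    (λ k → perfectlySuperimposable? (C a n (q * α)) (γ^ k (C b m (q * β))))
    (superimposable⇔ n⊥qα m⊥qβ (coprime-≤⇒< 1<n n⊥qα qα≤n) (coprime-≤⇒< 1<m m⊥qβ qβ≤m))
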